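{- Let $q=2$ and let $r>1$ be an integer. Then $$\zeta_A(1)\,\zeta_A(1,2,2^2,\dots,2^{r-1})=\zeta_A(1,3,2^2,\dots,2^{r-1})+\zeta_A(1,1,2,\dots,2^{r-2})^2.$$ Furthermore, $$\zeta_A(1,3,2^2,\dots,2^{r-1})=\frac{[r]-1}{L_1[r]}\cdot\frac{1}{\prod_{k=1}^{r-2}[k]^{2^{r-k}}}\cdot\frac{\tilde\pi^{2^r}}{L_1^{2^r}}=\frac{[r]-1}{L_1[r]}\cdot\frac{1}{\prod_{k=1}^{r-2}[k]^{2^{r-k}}}\,\zeta_A(2^r).$$
   Context: $A=\mathbb{F}_2[\theta]$, $A_+$ the monic polynomials, $[k]=\theta^{2^k}-\theta$, $L_k=[k][k-1]\cdots[1]$. For $s\in\mathbb{Z}$, $d\ge0$ let $S_d(s)=\sum_{a\in A_+,\deg a=d}a^{ -s}$. For positive integers $s_1,\dots,s_r$, $\zeta_A(s_1,\dots,s_r)=\sum_{d_1>\cdots>d_r\ge0}S_{d_1}(s_1)\cdots S_{d_r}(s_r)$, and $\zeta_A(k)=\sum_{a\in A_+}a^{ -k}$. The tuples are $(1,2^0,2^1,\dots,2^{r-1})$ with first entry $1$ replaced appropriately: $(1,2,\dots,2^{r-1})=(2^0,2^1,\dots,2^{r-1})$, $(1,3,2^2,\dots,2^{r-1})$ has depth $r$, and $(1,1,2,\dots,2^{r-2})=(1,2^0,2^1,\dots,2^{r-2})$ has depth $r$. $\tilde\pi=(-\theta)^{2}\prod_{i\ge1}(1-\theta^{1-2^i})^{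 -1}$ is a fundamental period of the Carlitz module. Empty products are $1$. -}

module Defs where

open import Data.Bool using (Bool; true; false; _xor_; _∧_; if_then_else_)
open import Data.Nat using (ℕ; zero; suc; _+_; _∸_; _^_; _<ᵇ_)
open import Data.List using (List; []; _∷_; _++_; reverse; concatMap; map; upTo; replicate; foldr)

-- F₂ = Bool (addition = xor, multiplication = ∧).

Σ< : ℕ → (ℕ → Bool) → Bool
Σ< zero    h = false
Σ< (suc n) h = Σ< n h xor h n

nth : List Bool → ℕ → Bool
nth []       _       = false
nth (b ∷ bs) zero    = b
nth (b ∷ bs) (suc k) = nth bs k

-- Power series in 1/θ over F₂:  f ↦ Σ_{n ≥ 0} f n · θ^{-n}.

PS : Set
PS = ℕ → Bool

0ₚ : PS
0ₚ _ = false

1ₚ : PS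
1ₚ zero    = true
1ₚ (suc _) = false

_⊕_ : PS → PS → PS
(f ⊕ g) n = f n xor g n

_⊛_ : PS → PS → PS
(f ⊛ g) n = Σ< (suc n) (λ i → f i ∧ g (n ∸ i))

infixl 6 _⊕_
infixl 7 _⊛_

_^ₚ_ : PS → ℕ → PS
f ^ₚ zero  = 1ₚ
f ^ₚ suc s = f ⊛ (f ^ₚ s)

shift : ℕ → PS → PS
shift d f n = if n <ᵇ d then false else f (n ∸ d)

_≗ₚ_ : PS → PS → Set
f ≗ₚ g = ∀ n → f n ≡' g n
  where open import Relation.Binary.PropositionalEquality renaming (_≡_ to _≡'_)

sumPS : List PS → PS
sumPS = foldr _⊕_ 0ₚ

prodPS : List PS → PS
prodPS = foldr _⊛_ 1ₚ

-- (1 + u)⁻¹ for u with zero constant term.  In characteristic 2,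
-- w₀ = 1 and wₙ = Σ_{k=1}^{n} u_k w_{n-k}.  wList n = [w₀, …, wₙ].
wList : PS → ℕ → List Bool
wList u zero    = true ∷ []
wList u (suc n) =
  wList u n ++ (Σ< (suc n) (λ j → u (suc j) ∧ nth (wList u n) (n ∸ j)) ∷ [])

inv1p : PS → PS
inv1p u n = nth (wList u n) n

-- Polynomials in F₂[θ] as coefficient lists, lowest degree first.

Poly : Set
Poly = List Bool

-- for p of list length L:  θ^{-L} · p  as a power series in 1/θ
toPSrev : Poly → PS
toPSrev p zero    = false
toPSrev p (suc k) = nth (reverse p) k

allLists : ℕ → List (List Bool)
allLists zero    = [] ∷ []
allLists (suc d) = concatMap (λ l → (false ∷ l) ∷ (true ∷ l) ∷ []) (allLists d)

-- a = θ^d + l (l the d lower coefficients);  a⁻¹ = θ^{-d} (1 + θ^{-d} l)⁻¹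
recipMonic : List Bool → PS
recipMonic l = shift (Data.List.length l) (inv1p (toPSrev l))
  where import Data.List

-- 1/p for a nonzero polynomial p whose list ends in its leading coefficient 1
-- (over F₂ every nonzero polynomial is monic); junk value 0 otherwise.
recipPoly : Poly → PS
recipPoly p with reverse p
... | true ∷ rest = recipMonic (reverse rest)
... | _           = 0ₚ

addP : Poly → Poly → Poly
addP []       q        = q
addP (a ∷ p)  []       = a ∷ p
addP (a ∷ p)  (b ∷ q)  = (a xor b) ∷ addP p q

mono : ℕ → Poly
mono n = replicate n false ++ (true ∷ [])

brk : ℕ → Poly
brk k = addP (mono (2 ^ k)) (mono 1)

L₁ : Poly
L₁ = brk 1

S : ℕ → ℕ → PS
S d s = sumPS (map (λ l → recipMonic l ^ₚ s) (allLists d))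

Z : List ℕ → ℕ → PS
Z []       D = 1ₚ
Z (s ∷ ss) D = sumPS (map (λ d → S d s ⊛ Z ss d) (upTo D))

-- ζ_A(s₁,…,s_r) ∈ F₂[[1/θ]] as the 1/θ-adic limit of the partial sums:
-- terms with d₁ > n have valuation ≥ d₁ s₁ > n, so the coefficient of
-- θ^{-n} of the full sum is that of the partial sum over d₁ ≤ n.
ζA : List ℕ → PS
ζA ss n = Z ss (suc n) n

-- Laurent series θ^e · f  (f ∈ F₂[[1/θ]]), enough for the period.

record Laurent : Set where
  constructor θ^_·_
  field
    ex  : ℕ
    ser : PS

_·L_ : Laurent → Laurent → Laurent
(θ^ e · f) ·L (θ^ e' · g) = θ^ (e + e') · (f ⊛ g)
infixl 7 _·L_

-- θ^e f = θ^{e'} g  iff  θ^{-e'} f = θ^{-e} g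
_≈L_ : Laurent → Laurent → Set
(θ^ e · f) ≈L (θ^ e' · g) = shift e' f ≗ₚ shift e g

oneL : Laurent
oneL = θ^ 0 · 1ₚ

_^L_ : Laurent → ℕ → Laurent
x ^L zero  = oneL
x ^L suc n = x ·L (x ^L n)

prodL : List Laurent → Laurent
prodL = foldr _·L_ oneL

ser→L : PS → Laurent
ser→L f = θ^ 0 · f

poly→L : Poly → Laurent
poly→L p = θ^ (Data.List.length p) · toPSrev p
  where import Data.List

recipL : Poly → Laurent
recipL p = θ^ 0 · recipPoly p

-- ∏_{i ≥ 1} (1 - θ^{1-2^i})⁻¹ as a 1/θ-adic limit: for the coefficient of
-- θ^{-n} only the factors with 2^i - 1 ≤ n matter, so i ≤ n+1 suffices.
-- Note 1 - θ^{1-2^i} = 1 + θ^{-(2^i - 1)} over F₂.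
πProd : PS
πProd n = prodPS (map (λ j → inv1p (shift (2 ^ suc j ∸ 1) 1ₚ)) (upTo (suc n))) n

-- π̃ = (-θ)^2 ∏_{i≥1} (1 - θ^{1-2^i})⁻¹ = θ² · πProd
π̃ : Laurent
π̃ = θ^ 2 · πProd

tupA : ℕ → List ℕ
tupA r = map (2 ^_) (upTo r)

tupB : ℕ → List ℕ
tupB r = 1 ∷ 3 ∷ map (λ i → 2 ^ (i + 2)) (upTo (r ∸ 2))

tupC : ℕ → List ℕ
tupC r = 1 ∷ map (2 ^_) (upTo (r ∸ 1))

coeff : ℕ → Laurent
coeff r = poly→L (addP (brk r) (true ∷ [])) ·L recipL L₁ ·L recipL (brk r)
          ·L prodL (map (λ j → recipL (brk (suc j)) ^L (2 ^ (r ∸ suc j))) (upTo (r ∸ 2)))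

{-# OPTIONS --safe #-}
module Submission where

-- With e_d(x) = ∏_{deg a < d} (x + a) and D_d = e_d(θ^d) = [d] D_{d-1}², the identities
--   e_d(x) ∑ 1/(x + a) = c  and  e_d(x)³ ∑ 1/(x + a)³ = c³ + c b e_d(x),
-- where c, b are the coefficients of x, x² in e_d, follow by induction on d because
-- e_{d+1}(x) = e_d(x)(e_d(x) + D_d).  At x = θ^d they give S_d(1) = 1/L_d and
-- S_d(3) = S_d(1)² ∑_{f ≤ d} S_f(1).  The second one makes the sum formula hold already for
-- the truncated sums.  For the evaluation, the truncated sums have closed forms: with all
-- degrees < m + r,
--   Z(1, 2, …, 2^{r-1}) = L_{m+r} / (D_r L_m^{2^r})  and
--   Z(1, 1, 2, …, 2^{r-1}) = (∑_{d < m} S_d(2^r)) / D_r.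
-- In the 1/θ-adic limit both are explicit multiples of powers of ζ(1), and ζ(1) = π̃/[1]
-- since [1] ∑_{d ≤ n} S_d(1) = [n+1]/L_n.

open import Algebra.Bundles using (CommutativeRing; CommutativeSemiring)
import Algebra.Properties.Semiring.Exp
import Algebra.Solver.Ring
open import Algebra.Solver.Ring.AlmostCommutativeRing using (fromCommutativeSemiring; _-Raw-AlmostCommutative⟶_)
open import Algebra.Structures.Biased using (isCommutativeSemiringˡ)
open import Data.Bool using (Bool; true; false; if_then_else_; _xor_; _∧_)
open import Data.Bool.Properties using (xor-∧-commutativeRing; xor-assoc; xor-comm; xor-identityʳ; xor-same; ∧-comm; ∧-distribʳ-xor; ∧-identityʳ; ∧-zeroʳ)
open import Data.List using (List; []; _∷_; _++_; _∷ʳ_; map; length; reverse; replicate; foldr; upTo; applyUpTo; concatMap)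
open import Data.List.Properties using (++-identityʳ; ++-assoc; length-++; length-reverse; reverse-++; reverse-involutive; unfold-reverse; map-upTo; map-∘; map-cong; map-applyUpTo)
open import Data.Maybe using (Maybe; just; nothing)
open import Data.Nat as ℕ using (ℕ; zero; suc; z≤n; s≤s)
import Data.Nat.Properties as ℕ
open import Data.Product using (∃; _×_; _,_; proj₂)
open import Defs
open import Level using (0ℓ)
open import Relation.Binary.PropositionalEquality as ≡ using (_≡_)
import Relation.Binary.Reasoning.Setoid
open import Relation.Binary.Structures using (IsEquivalence)

-- Commutative rings of characteristic 2

-- The numerator and the denominator of the closed form of Z(1, 2, ..., 2^{r-1}) both diverge. Its
-- product with [1] ∑ S_d(1) = [n+1]/L_n, where n + 1 = m + r, is [n+1]² / (D_r L_m^{2^r}), and this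
-- differs from a constant multiple of (∑_{d ≤ m} S_d(1))^{2^r} only by a null sequence. So ζ(1)
-- ζ(1, 2, ..., 2^{r-1}) is the quantity with a convenient limit, and the sum formula becomes the
-- tool of the evaluation: it presents ζ(1, 3, 4, ...) as a sum of two explicit multiples of
-- ζ(1)^{2^r}, because ζ(1, 1, 2, ..., 2^{r-2})² is ζ(2, 2, 4, ..., 2^{r-1}) by Frobenius. Every
-- identity is proved for finite truncated sums; infinite sums enter only through uniqueness of
-- limits. In characteristic 2 subtraction is addition, so commutative semirings carry the argument.
-- As θ is not in F₂[[1/θ]], the computation takes place in the localisation at 1/θ, whose elements
-- are fractions compared by cross-multiplication, without a normal form.

CharTwo : CommutativeSemiring 0ℓ 0ℓ → Set
CharTwo K = 1# + 1# ≈ 0#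
  where open CommutativeSemiring K

module CharTwoSolver (K : CommutativeSemiring 0ℓ 0ℓ) (char2 : CharTwo K) where
  open CommutativeSemiring K
  open Algebra.Properties.Semiring.Exp semiring

  bit : Bool → Carrier
  bit b = if b then 1# else 0#

  private
    -- With F₂ itself as the coefficient ring, the solver reduces coefficients modulo 2, so that
    -- identities special to characteristic 2 are within its reach.
    F₂⟶K : CommutativeRing.rawRing xor-∧-commutativeRing
             -Raw-AlmostCommutative⟶ fromCommutativeSemiring K
    F₂⟶K = record
      { ⟦_⟧    = bit
      ; +-homo = λ where
          true  true  → sym char2
          true  false → sym (+-identityʳ 1#)
          false b     → sym (+-identityˡ (bit b))
      ; *-homo = λ where
          true  b → sym (*-identityˡ (bit b))
          false b → sym (zeroˡ (bit b))
      ; -‿homo = λ _ → refl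
      ; 0-homo = refl
      ; 1-homo = refl
      }

    _≟bit_ : (a b : Bool) → Maybe (bit a ≈ bit b)
    true  ≟bit true  = just refl
    false ≟bit false = just refl
    _     ≟bit _     = nothing

  open Algebra.Solver.Ring _ _ F₂⟶K _≟bit_ public
    using (solve; con; _:=_; _:+_; _:*_; _:^_)

  x+x≈0 : ∀ x → x + x ≈ 0#
  x+x≈0 = solve 1 (λ x → x :+ x := con false) refl

  +-moveʳ : ∀ {x y z} → x ≈ y + z → x + z ≈ y
  +-moveʳ {x} {y} {z} x≈y+z =
    trans (+-congʳ x≈y+z) (solve 2 (λ y z → (y :+ z) :+ z := y) refl y z)

  infixr 8 _^2^_

  -- The iterated Frobenius, x to the power 2^k. Squaring at each step lets additivity go by
  -- induction and shows the solver a plain product.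
  _^2^_ : Carrier → ℕ → Carrier
  x ^2^ zero  = x
  x ^2^ suc k = (x ^2^ k) * (x ^2^ k)

  ^2^-cong : ∀ k {x y} → x ≈ y → x ^2^ k ≈ y ^2^ k
  ^2^-cong zero    x≈y = x≈y
  ^2^-cong (suc k) x≈y = *-cong (^2^-cong k x≈y) (^2^-cong k x≈y)

  ^2^-+ : ∀ k x y → (x + y) ^2^ k ≈ x ^2^ k + y ^2^ k
  ^2^-+ zero    x y = refl
  ^2^-+ (suc k) x y = trans (*-cong (^2^-+ k x y) (^2^-+ k x y))
    (solve 2 (λ a b → (a :+ b) :* (a :+ b) := a :* a :+ b :* b) refl (x ^2^ k) (y ^2^ k))

  ^2^-* : ∀ k x y → (x * y) ^2^ k ≈ x ^2^ k * y ^2^ k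
  ^2^-* zero    x y = refl
  ^2^-* (suc k) x y = trans (*-cong (^2^-* k x y) (^2^-* k x y))
    (solve 2 (λ a b → (a :* b) :* (a :* b) := (a :* a) :* (b :* b)) refl (x ^2^ k) (y ^2^ k))

  ^2^-1 : ∀ k → 1# ^2^ k ≈ 1#
  ^2^-1 zero    = refl
  ^2^-1 (suc k) = trans (*-cong (^2^-1 k) (^2^-1 k)) (*-identityˡ 1#)

  ^-double : ∀ x s → x ^ (2 ℕ.* s) ≈ x ^ s * x ^ s
  ^-double x s = trans (^-congʳ x (≡.cong (s ℕ.+_) (ℕ.+-identityʳ s))) (^-homo-* x s s)

  ^≈^2^ : ∀ x k → x ^ (2 ℕ.^ k) ≈ x ^2^ k
  ^≈^2^ x zero    = *-identityʳ x
  ^≈^2^ x (suc k) = trans (^-double x (2 ℕ.^ k)) (*-cong (^≈^2^ x k) (^≈^2^ x k))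

  -- The value at θ of the monic polynomial of degree (length l) whose lower coefficients are l.
  monicAt : Carrier → List Bool → Carrier
  monicAt θ []      = 1#
  monicAt θ (b ∷ l) = bit b + θ * monicAt θ l

  monicAt-replicate : ∀ θ n → monicAt θ (replicate n false) ≈ θ ^ n
  monicAt-replicate θ zero    = refl
  monicAt-replicate θ (suc n) = trans (+-identityˡ _) (*-congˡ (monicAt-replicate θ n))

  monicAt-trinomial : ∀ θ b n → monicAt θ (b ∷ true ∷ replicate n false) ≈ (θ ^ (2 ℕ.+ n) + θ) + bit b
  monicAt-trinomial θ b n = trans (+-congˡ (*-congˡ (+-congˡ (*-congˡ (monicAt-replicate θ n)))))
    (solve 3 (λ b θ t → b :+ θ :* (con true :+ θ :* t) := (θ :* (θ :* t) :+ θ) :+ b) refl (bit b) θ (θ ^ n))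

-- Localisation at the powers of one element

-- The powers of the inverted element come as a family, since for power series they will be shifts
-- of 1, which compute. `U-cancel` says that none of them is a zero divisor.
record Denominators (R : CommutativeSemiring 0ℓ 0ℓ) : Set where
  open CommutativeSemiring R
  field
    U        : ℕ → Carrier
    U-0      : U 0 ≈ 1#
    U-+      : ∀ m n → U (m ℕ.+ n) ≈ U m * U n
    U-cancel : ∀ n {x y} → U n * x ≈ U n * y → x ≈ y

module Localisation
  (R : CommutativeSemiring 0ℓ 0ℓ) (char2 : CharTwo R) (denominators : Denominators R) where

  open CommutativeSemiring R
  open Denominators denominators
  open CharTwoSolver R char2
  open Relation.Binary.Reasoning.Setoid setoid

  infix 6 _/U^_
  record Fraction : Set where
    constructor _/U^_
    field
      num : Carrier
      exp : ℕ

  -- A record, so that the fractions can be inferred from a proof of their equality.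
  infix 4 _≈F_
  record _≈F_ (x y : Fraction) : Set where
    constructor cross
    open Fraction
    field
      uncross : U (exp y) * num x ≈ U (exp x) * num y

  open _≈F_ public

  infixl 6 _+F_
  infixl 7 _*F_

  _+F_ _*F_ : Fraction → Fraction → Fraction
  (x /U^ a) +F (y /U^ b) = (U b * x + U a * y) /U^ (a ℕ.+ b)
  (x /U^ a) *F (y /U^ b) = (x * y) /U^ (a ℕ.+ b)

  0F 1F : Fraction
  0F = 0# /U^ 0
  1F = 1# /U^ 0

  same-exp : ∀ {x y a b} → a ≡ b → x ≈ y → (x /U^ a) ≈F (y /U^ b)
  same-exp ≡.refl x≈y = cross (*-congˡ x≈y)

  ≈F-trans : ∀ {x y z} → x ≈F y → y ≈F z → x ≈F z
  ≈F-trans {x /U^ a} {y /U^ b} {z /U^ c} (cross x≈y) (cross y≈z) = cross (U-cancel b (begin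
    U b * (U c * x)  ≈⟨ swap (U b) (U c) x ⟩
    U c * (U b * x)  ≈⟨ *-congˡ x≈y ⟩
    U c * (U a * y)  ≈⟨ swap (U c) (U a) y ⟩
    U a * (U c * y)  ≈⟨ *-congˡ y≈z ⟩
    U a * (U b * z)  ≈⟨ swap (U a) (U b) z ⟩
    U b * (U a * z)  ∎))
    where
    swap : ∀ a b x → a * (b * x) ≈ b * (a * x)
    swap = solve 3 (λ a b x → a :* (b :* x) := b :* (a :* x)) refl

  ≈F-isEquivalence : IsEquivalence _≈F_
  ≈F-isEquivalence = record
    { refl  = cross refl
    ; sym   = λ x≈y → cross (sym (uncross x≈y))
    ; trans = ≈F-trans
    }

  +F-cong : ∀ {x x′ y y′} → x ≈F x′ → y ≈F y′ → x +F y ≈F x′ +F y′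
  +F-cong {x /U^ a} {x′ /U^ a′} {y /U^ b} {y′ /U^ b′} (cross x≈) (cross y≈) = cross (begin
    U (a′ ℕ.+ b′) * (U b * x + U a * y)
      ≈⟨ *-congʳ (U-+ a′ b′) ⟩
    (U a′ * U b′) * (U b * x + U a * y)
      ≈⟨ solve 6 (λ a a′ b b′ x y → (a′ :* b′) :* (b :* x :+ a :* y)
           := (b :* b′) :* (a′ :* x) :+ (a :* a′) :* (b′ :* y)) refl (U a) (U a′) (U b) (U b′) x y ⟩
    (U b * U b′) * (U a′ * x) + (U a * U a′) * (U b′ * y)
      ≈⟨ +-cong (*-congˡ x≈) (*-congˡ y≈) ⟩
    (U b * U b′) * (U a * x′) + (U a * U a′) * (U b * y′)
      ≈⟨ solve 6 (λ a a′ b b′ x y → (b :* b′) :* (a :* x) :+ (a :* a′) :* (b :* y)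
           := (a :* b) :* (b′ :* x :+ a′ :* y)) refl (U a) (U a′) (U b) (U b′) x′ y′ ⟩
    (U a * U b) * (U b′ * x′ + U a′ * y′)
      ≈⟨ *-congʳ (U-+ a b) ⟨
    U (a ℕ.+ b) * (U b′ * x′ + U a′ * y′) ∎)

  +F-assoc : ∀ x y z → (x +F y) +F z ≈F x +F (y +F z)
  +F-assoc (x /U^ a) (y /U^ b) (z /U^ c) = same-exp (ℕ.+-assoc a b c) (begin
    U c * (U b * x + U a * y) + U (a ℕ.+ b) * z
      ≈⟨ +-congˡ (*-congʳ (U-+ a b)) ⟩
    U c * (U b * x + U a * y) + (U a * U b) * z
      ≈⟨ solve 6 (λ a b c x y z → c :* (b :* x :+ a :* y) :+ (a :* b) :* z
           := (b :* c) :* x :+ a :* (c :* y :+ b :* z)) refl (U a) (U b) (U c) x y z ⟩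
    (U b * U c) * x + U a * (U c * y + U b * z)
      ≈⟨ +-congʳ (*-congʳ (U-+ b c)) ⟨
    U (b ℕ.+ c) * x + U a * (U c * y + U b * z) ∎)

  +F-comm : ∀ x y → x +F y ≈F y +F x
  +F-comm (x /U^ a) (y /U^ b) = same-exp (ℕ.+-comm a b) (+-comm (U b * x) (U a * y))

  +F-identityˡ : ∀ x → 0F +F x ≈F x
  +F-identityˡ (x /U^ a) = same-exp ≡.refl (trans (+-congˡ (*-congʳ U-0))
    (solve 2 (λ a x → a :* con false :+ con true :* x := x) refl (U a) x))

  *F-cong : ∀ {x x′ y y′} → x ≈F x′ → y ≈F y′ → x *F y ≈F x′ *F y′
  *F-cong {x /U^ a} {x′ /U^ a′} {y /U^ b} {y′ /U^ b′} (cross x≈) (cross y≈) = cross (begin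
    U (a′ ℕ.+ b′) * (x * y)       ≈⟨ *-congʳ (U-+ a′ b′) ⟩
    (U a′ * U b′) * (x * y)       ≈⟨ interchange (U a′) (U b′) x y ⟩
    (U a′ * x) * (U b′ * y)       ≈⟨ *-cong x≈ y≈ ⟩
    (U a * x′) * (U b * y′)       ≈⟨ interchange (U a) (U b) x′ y′ ⟨
    (U a * U b) * (x′ * y′)       ≈⟨ *-congʳ (U-+ a b) ⟨
    U (a ℕ.+ b) * (x′ * y′)       ∎)
    where
    interchange : ∀ a b x y → (a * b) * (x * y) ≈ (a * x) * (b * y)
    interchange = solve 4 (λ a b x y → (a :* b) :* (x :* y) := (a :* x) :* (b :* y)) refl

  *F-comm : ∀ x y → x *F y ≈F y *F x
  *F-comm (x /U^ a) (y /U^ b) = same-exp (ℕ.+-comm a b) (*-comm x y)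

  *F-distribʳ : ∀ z x y → (x +F y) *F z ≈F x *F z +F y *F z
  *F-distribʳ (z /U^ c) (x /U^ a) (y /U^ b) = cross (begin
    U ((a ℕ.+ c) ℕ.+ (b ℕ.+ c)) * ((U b * x + U a * y) * z)
      ≈⟨ *-congʳ (trans (U-+ (a ℕ.+ c) (b ℕ.+ c)) (*-cong (U-+ a c) (U-+ b c))) ⟩
    ((U a * U c) * (U b * U c)) * ((U b * x + U a * y) * z)
      ≈⟨ solve 6 (λ a b c x y z → ((a :* c) :* (b :* c)) :* ((b :* x :+ a :* y) :* z)
           := ((a :* b) :* c) :* ((b :* c) :* (x :* z) :+ (a :* c) :* (y :* z))) refl
           (U a) (U b) (U c) x y z ⟩
    ((U a * U b) * U c) * ((U b * U c) * (x * z) + (U a * U c) * (y * z))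
      ≈⟨ *-cong (trans (U-+ (a ℕ.+ b) c) (*-congʳ (U-+ a b)))
                (+-cong (*-congʳ (U-+ b c)) (*-congʳ (U-+ a c))) ⟨
    U ((a ℕ.+ b) ℕ.+ c) * (U (b ℕ.+ c) * (x * z) + U (a ℕ.+ c) * (y * z)) ∎)

  *F-zeroˡ : ∀ x → 0F *F x ≈F 0F
  *F-zeroˡ (x /U^ a) = cross
    (solve 3 (λ o a x → o :* (con false :* x) := a :* con false) refl (U 0) (U a) x)

  fractions : CommutativeSemiring 0ℓ 0ℓ
  fractions = record
    { Carrier = Fraction
    ; _≈_ = _≈F_
    ; _+_ = _+F_
    ; _*_ = _*F_
    ; 0#  = 0F
    ; 1#  = 1F
    ; isCommutativeSemiring = isCommutativeSemiringˡ record
      { +-isCommutativeMonoid = record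
        { isMonoid = record
          { isSemigroup = record
            { isMagma = record { isEquivalence = ≈F-isEquivalence ; ∙-cong = +F-cong }
            ; assoc = +F-assoc
            }
          ; identity = +F-identityˡ , λ x → ≈F-trans (+F-comm x 0F) (+F-identityˡ x)
          }
        ; comm = +F-comm
        }
      ; *-isCommutativeMonoid = record
        { isMonoid = record
          { isSemigroup = record
            { isMagma = record { isEquivalence = ≈F-isEquivalence ; ∙-cong = *F-cong }
            ; assoc = λ where
                (x /U^ a) (y /U^ b) (z /U^ c) → same-exp (ℕ.+-assoc a b c) (*-assoc x y z)
            }
          ; identity = (λ where (x /U^ a) → same-exp ≡.refl (*-identityˡ x))
                     , (λ where (x /U^ a) → same-exp (ℕ.+-identityʳ a) (*-identityʳ x))
          }
        ; comm = *F-comm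
        }
      ; distribʳ = *F-distribʳ
      ; zeroˡ = *F-zeroˡ
      }
    }

  fractions-char2 : CharTwo fractions
  fractions-char2 = same-exp ≡.refl
    (solve 1 (λ o → o :* con true :+ o :* con true := con false) refl (U 0))

  ι : Carrier → Fraction
  ι x = x /U^ 0

  ι-cong : ∀ {x y} → x ≈ y → ι x ≈F ι y
  ι-cong = same-exp ≡.refl

  ι-+ : ∀ x y → ι (x + y) ≈F ι x +F ι y
  ι-+ x y = same-exp ≡.refl (sym (trans (+-cong (*-congʳ U-0) (*-congʳ U-0))
    (+-cong (*-identityˡ x) (*-identityˡ y))))

  ι-injective : ∀ {x y} → ι x ≈F ι y → x ≈ y
  ι-injective eq = U-cancel 0 (uncross eq)

  open CommutativeSemiring fractions using () renaming (semiring to fractions-semiring)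
  open Algebra.Properties.Semiring.Exp fractions-semiring using () renaming (_^_ to _^F_)

  -- The element to be inverted is 1/θ, so θ is the fraction 1 over `U 1`.
  θF uF : Fraction
  θF = 1# /U^ 1
  uF = ι (U 1)

  θF^ : ∀ n → θF ^F n ≈F 1# /U^ n
  θF^ zero    = cross refl
  θF^ (suc n) = ≈F-trans (*F-cong (cross refl) (θF^ n)) (same-exp ≡.refl (*-identityˡ 1#))

  uF^ : ∀ n → uF ^F n ≈F ι (U n)
  uF^ zero    = ι-cong (sym U-0)
  uF^ (suc n) = ≈F-trans (*F-cong (cross refl) (uF^ n)) (ι-cong (sym (U-+ 1 n)))

  cancel-exp : ∀ m n x → (U m * x) /U^ (m ℕ.+ n) ≈F x /U^ n
  cancel-exp m n x = cross (begin
    U n * (U m * x)    ≈⟨ solve 3 (λ a b x → a :* (b :* x) := (b :* a) :* x) refl (U n) (U m) x ⟩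
    U m * U n * x      ≈⟨ *-congʳ (U-+ m n) ⟨
    U (m ℕ.+ n) * x    ∎)

  uF^-cancel : ∀ n x → uF ^F n *F (x /U^ n) ≈F ι x
  uF^-cancel n x = ≈F-trans (*F-cong (uF^ n) (cross refl))
    (≈F-trans (same-exp (≡.sym (ℕ.+-identityʳ n)) refl) (cancel-exp n 0 x))

  ι-U* : ∀ n x → ι (U n * x) ≈F uF ^F n *F ι x
  ι-U* n x = *F-cong (≈F-sym (uF^ n)) (cross refl)
    where open IsEquivalence ≈F-isEquivalence using () renaming (sym to ≈F-sym)

  -- A Horner step. Over the larger denominator, the new lowest coefficient lands on the highest
  -- power of 1/θ.
  bit+θF* : ∀ b x d →
    CharTwoSolver.bit fractions fractions-char2 b +F θF *F (x /U^ d) ≈F (x + bit b * U (suc d)) /U^ suc d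
  bit+θF* true  x d = same-exp ≡.refl (trans (+-congˡ (*-congʳ U-0))
    (solve 2 (λ a x → a :* con true :+ con true :* (con true :* x) := x :+ con true :* a) refl (U (suc d)) x))
  bit+θF* false x d = same-exp ≡.refl (trans (+-congˡ (*-congʳ U-0))
    (solve 2 (λ a x → a :* con false :+ con true :* (con true :* x) := x :+ con false :* a) refl (U (suc d)) x))

-- Power sums and multiple zeta values over a ring with the required inverses

-- The inverses of monic polynomials and of brackets are given as operations, so that no general
-- division is required and the algebra stays independent of how Laurent series are represented.
record CarlitzData : Set₁ where
  field
    K     : CommutativeSemiring 0ℓ 0ℓ
    char2 : CharTwo K

  open CommutativeSemiring K public hiding (_≉_)
  open CharTwoSolver K char2 public
  open Algebra.Properties.Semiring.Exp semiring public

  field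
    θ u : Carrier

  br : ℕ → Carrier
  br k = θ ^2^ k + θ

  monic : List Bool → Carrier
  monic = monicAt θ

  -- J k stands for 1/[k]; J 0 is arbitrary, since [0] = 0.
  field
    I         : List Bool → Carrier
    I-inverse : ∀ l → I l * monic l ≈ 1#
    J         : ℕ → Carrier
    J-inverse : ∀ k → J (suc k) * br (suc k) ≈ 1#

    -- The valuation ring, with `u` as uniformiser. `denominator` bounds the pole of each element,
    -- which makes multiplication continuous; `separated` makes limits unique.
    Integral      : Carrier → Set
    Integral-resp : ∀ {x y} → x ≈ y → Integral x → Integral y
    Integral-0    : Integral 0#
    Integral-1    : Integral 1#
    Integral-u    : Integral u
    Integral-+    : ∀ {x y} → Integral x → Integral y → Integral (x + y)
    Integral-*    : ∀ {x y} → Integral x → Integral y → Integral (x * y)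
    denominator   : ∀ x → ∃ λ e → Integral (u ^ e * x)

  Small : ℕ → Carrier → Set
  Small N x = ∃ λ y → Integral y × x ≈ u ^ N * y

  field
    I-small   : ∀ l → Small (length l) (I l)
    separated : ∀ {x} → (∀ N → Small N x) → x ≈ 0#

module Carlitz (𝒞 : CarlitzData) where
  open CarlitzData 𝒞
  open Relation.Binary.Reasoning.Setoid setoid

  -- Finite sums, power sums and Frobenius

  ∑ ∏ : ℕ → (ℕ → Carrier) → Carrier
  ∑ zero    h = 0#
  ∑ (suc n) h = ∑ n h + h n
  ∏ zero    h = 1#
  ∏ (suc n) h = ∏ n h * h n

  ∑-cong : ∀ n {h k} → (∀ i → h i ≈ k i) → ∑ n h ≈ ∑ n k
  ∑-cong zero    h≈k = refl
  ∑-cong (suc n) h≈k = +-cong (∑-cong n h≈k) (h≈k n)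

  ∑-zero : ∀ n {h} → (∀ i → i ℕ.< n → h i ≈ 0#) → ∑ n h ≈ 0#
  ∑-zero zero    h≈0 = refl
  ∑-zero (suc n) h≈0 = trans
    (+-cong (∑-zero n (λ i i<n → h≈0 i (ℕ.m<n⇒m<1+n i<n))) (h≈0 n ℕ.≤-refl)) (+-identityˡ 0#)

  ∑-square : ∀ n h → ∑ n h * ∑ n h ≈ ∑ n (λ i → h i * h i)
  ∑-square zero    h = zeroˡ 0#
  ∑-square (suc n) h = trans (^2^-+ 1 (∑ n h) (h n)) (+-congʳ (∑-square n h))

  ∑lists : ℕ → (List Bool → Carrier) → Carrier
  ∑lists zero    h = h []
  ∑lists (suc d) h = ∑lists d (λ l → h (false ∷ l) + h (true ∷ l))

  ∑lists-cong : ∀ d {h k} → (∀ l → h l ≈ k l) → ∑lists d h ≈ ∑lists d k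
  ∑lists-cong zero    h≈k = h≈k []
  ∑lists-cong (suc d) h≈k = ∑lists-cong d (λ l → +-cong (h≈k (false ∷ l)) (h≈k (true ∷ l)))

  ∑lists-+ : ∀ d h k → ∑lists d (λ l → h l + k l) ≈ ∑lists d h + ∑lists d k
  ∑lists-+ zero    h k = refl
  ∑lists-+ (suc d) h k = trans
    (∑lists-cong d (λ l → interchange (h (false ∷ l)) (k (false ∷ l)) (h (true ∷ l)) (k (true ∷ l))))
    (∑lists-+ d (λ l → h (false ∷ l) + h (true ∷ l)) (λ l → k (false ∷ l) + k (true ∷ l)))
    where
    interchange : ∀ a b c d → (a + b) + (c + d) ≈ (a + c) + (b + d)
    interchange = solve 4 (λ a b c d → (a :+ b) :+ (c :+ d) := (a :+ c) :+ (b :+ d)) refl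

  ∑lists-square : ∀ d h → ∑lists d h * ∑lists d h ≈ ∑lists d (λ l → h l * h l)
  ∑lists-square zero    h = refl
  ∑lists-square (suc d) h = trans (∑lists-square d (λ l → h (false ∷ l) + h (true ∷ l)))
    (∑lists-cong d (λ l → ^2^-+ 1 (h (false ∷ l)) (h (true ∷ l))))

  -- `∑lists` unfolds at the lowest coefficient, whereas the recursion of `e` adjoins the highest
  -- one; this passes from one to the other.
  ∑lists-∷ʳ : ∀ d h → ∑lists (suc d) h ≈ ∑lists d (λ l → h (l ∷ʳ false)) + ∑lists d (λ l → h (l ∷ʳ true))
  ∑lists-∷ʳ zero    h = refl
  ∑lists-∷ʳ (suc d) h = ∑lists-∷ʳ d (λ l → h (false ∷ l) + h (true ∷ l))

  -- S_d(s), and the part of ζ_A(ss) with d₁ < D.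
  Sd : ℕ → ℕ → Carrier
  Sd d s = ∑lists d (λ l → I l ^ s)

  Z< : List ℕ → ℕ → Carrier
  Z< []       D = 1#
  Z< (s ∷ ss) D = ∑ D (λ d → Sd d s * Z< ss d)

  Sd-double : ∀ d s → Sd d (2 ℕ.* s) ≈ Sd d s * Sd d s
  Sd-double d s = trans (∑lists-cong d (λ l → ^-double (I l) s)) (sym (∑lists-square d (λ l → I l ^ s)))

  -- Squaring is additive, so it can be moved inside each of the nested sums.
  Z<-double : ∀ ss D → Z< (map (2 ℕ.*_) ss) D ≈ Z< ss D * Z< ss D
  Z<-double []       D = sym (*-identityˡ 1#)
  Z<-double (s ∷ ss) D = trans
    (∑-cong D (λ d → trans (*-cong (Sd-double d s) (Z<-double ss d)) (sym (^2^-* 1 (Sd d s) (Z< ss d)))))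
    (sym (∑-square D (λ d → Sd d s * Z< ss d)))

  -- e_d(x) is the product of x + a over the polynomials a of degree < d.
  e : ℕ → Carrier → Carrier
  e zero    x = x
  e (suc d) x = e d x * (e d x + e d (θ ^ d))

  D : ℕ → Carrier
  D d = e d (θ ^ d)

  e-cong : ∀ d {x y} → x ≈ y → e d x ≈ e d y
  e-cong zero    x≈y = x≈y
  e-cong (suc d) x≈y = *-cong (e-cong d x≈y) (+-congʳ (e-cong d x≈y))

  e-+ : ∀ d x y → e d (x + y) ≈ e d x + e d y
  e-+ zero    x y = refl
  e-+ (suc d) x y = trans (*-cong (e-+ d x y) (+-congʳ (e-+ d x y)))
    (solve 3 (λ a b w → (a :+ b) :* ((a :+ b) :+ w) := a :* (a :+ w) :+ b :* (b :+ w)) refl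
      (e d x) (e d y) (D d))

  mutual
    -- The induction step needs the value of `D (suc d)`. That value is the case x = θ^d of the same
    -- equation, where the term with the factor θ vanishes because θ^d is a root of `e (suc d)`.
    -- Hence the mutual block.
    e-θ : ∀ d x → e (suc d) (θ * x) ≈ θ * e (suc d) x + br (suc d) * (e d x * e d x)
    e-θ zero    x = solve 2 (λ θ x → (θ :* x) :* (θ :* x :+ con true)
        := θ :* (x :* (x :+ con true)) :+ (θ :* θ :+ θ) :* (x :* x)) refl θ x
    e-θ (suc d) x = begin
      e (suc d) (θ * x) * (e (suc d) (θ * x) + D (suc d))
        ≈⟨ *-cong (e-θ d x) (+-cong (e-θ d x) (D-suc d)) ⟩
      (θ * e (suc d) x + br (suc d) * (y * y)) *
        ((θ * e (suc d) x + br (suc d) * (y * y)) + br (suc d) * (D d * D d))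
        ≈⟨ solve 4 (λ θ t y w →
             (θ :* (y :* (y :+ w)) :+ (t :+ θ) :* (y :* y)) :*
               ((θ :* (y :* (y :+ w)) :+ (t :+ θ) :* (y :* y)) :+ (t :+ θ) :* (w :* w))
             := θ :* ((y :* (y :+ w)) :* ((y :* (y :+ w)) :+ (t :+ θ) :* (w :* w)))
                :+ (t :* t :+ θ) :* ((y :* (y :+ w)) :* (y :* (y :+ w)))) refl
             θ (θ ^2^ suc d) y (D d) ⟩
      θ * (e (suc d) x * (e (suc d) x + br (suc d) * (D d * D d)))
        + br (suc (suc d)) * (e (suc d) x * e (suc d) x)
        ≈⟨ +-congʳ (*-congˡ (*-congˡ (+-congˡ (D-suc d)))) ⟨
      θ * e (suc (suc d)) x + br (suc (suc d)) * (e (suc d) x * e (suc d) x) ∎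
      where
      y : Carrier
      y = e d x

    D-suc : ∀ d → D (suc d) ≈ br (suc d) * (D d * D d)
    D-suc d = trans (e-θ d (θ ^ d))
      (solve 3 (λ θ w z → θ :* (w :* (w :+ w)) :+ z := z) refl θ (D d) (br (suc d) * (D d * D d)))

  -- The coefficients of x and x² in e_d(x).
  c b : ℕ → Carrier
  c zero    = 1#
  c (suc d) = c d * D d
  b zero    = 0#
  b (suc d) = c d * c d + D d * b d

  e-false∷ : ∀ d m → e d (θ ^ d * monic (false ∷ m)) ≈ e d (θ ^ suc d * monic m)
  e-false∷ d m = e-cong d (solve 3 (λ θ t x → t :* (con false :+ θ :* x) := (θ :* t) :* x) refl θ (θ ^ d) (monic m))

  e-true∷ : ∀ d m → e d (θ ^ d * monic (true ∷ m)) ≈ e d (θ ^ suc d * monic m) + D d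
  e-true∷ d m = trans
    (e-cong d (solve 3 (λ θ t x → t :* (con true :+ θ :* x) := (θ :* t) :* x :+ t) refl θ (θ ^ d) (monic m)))
    (e-+ d (θ ^ suc d * monic m) (θ ^ d))

  ∑lists-split : ∀ d (g : Carrier → Carrier) m →
    ∑lists (suc d) (λ l → g (I (l ++ m)))
      ≈ ∑lists d (λ l → g (I (l ++ false ∷ m))) + ∑lists d (λ l → g (I (l ++ true ∷ m)))
  ∑lists-split d g m = trans (∑lists-∷ʳ d (λ l → g (I (l ++ m)))) (+-cong (move false) (move true))
    where
    move : ∀ b → ∑lists d (λ l → g (I ((l ∷ʳ b) ++ m))) ≈ ∑lists d (λ l → g (I (l ++ b ∷ m)))
    move b = ∑lists-cong d (λ l → reflexive (≡.cong (λ l′ → g (I l′)) (++-assoc l (b ∷ []) m)))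

  -- The logarithmic derivative of e_d: as e_d is additive, its derivative is the constant `c d`.
  -- The list `m` holds the coefficients from θ^d upwards, so x = θ^d · `monic m` and x + a runs
  -- over the lists `l ++ m`. It is kept general because the induction moves the top coefficient of
  -- `l` into `m`, which adds 0 or `D d` to e_d(x).
  ∑I : ∀ d m → ∑lists d (λ l → I (l ++ m)) * e d (θ ^ d * monic m) ≈ c d
  ∑I zero    m = trans (*-congˡ (*-identityˡ (monic m))) (I-inverse m)
  ∑I (suc d) m = begin
    ∑lists (suc d) (λ l → I (l ++ m)) * (E * (E + D d))
      ≈⟨ *-congʳ (∑lists-split d (λ x → x) m) ⟩
    (f₀ + f₁) * (E * (E + D d))
      ≈⟨ solve 4 (λ f₀ f₁ E w → (f₀ :+ f₁) :* (E :* (E :+ w))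
           := (f₀ :* E) :* (E :+ w) :+ (f₁ :* (E :+ w)) :* E) refl f₀ f₁ E (D d) ⟩
    (f₀ * E) * (E + D d) + (f₁ * (E + D d)) * E
      ≈⟨ +-cong (*-congʳ (trans (*-congˡ (sym (e-false∷ d m))) (∑I d (false ∷ m))))
                (*-congʳ (trans (*-congˡ (sym (e-true∷ d m))) (∑I d (true ∷ m)))) ⟩
    c d * (E + D d) + c d * E
      ≈⟨ solve 3 (λ c E w → c :* (E :+ w) :+ c :* E := c :* w) refl (c d) E (D d) ⟩
    c d * D d ∎
    where
    E f₀ f₁ : Carrier
    E  = e d (θ ^ suc d * monic m)
    f₀ = ∑lists d (λ l → I (l ++ false ∷ m))
    f₁ = ∑lists d (λ l → I (l ++ true ∷ m))

  -- The right side comes from Newton's identity p₃ = s₁³ + s₁s₂ + s₃ modulo 2 for the elements 1/(x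
  -- + a). Their generating polynomial e_d(x + t)/e_d(x) has s₁ = c/e_d(x), s₂ = b/e_d(x) and s₃ =
  -- 0, as e_d contains only powers t^{2^i}. The proof checks it by the induction of `∑I`.
  ∑I³ : ∀ d m → ∑lists d (λ l → I (l ++ m) ^ 3) * e d (θ ^ d * monic m) ^ 3
              ≈ c d ^ 3 + c d * b d * e d (θ ^ d * monic m)
  ∑I³ zero    m = begin
    I m ^ 3 * (1# * monic m) ^ 3
      ≈⟨ solve 2 (λ i x → (i :^ 3) :* ((con true :* x) :^ 3) := (i :* x) :^ 3) refl (I m) (monic m) ⟩
    (I m * monic m) ^ 3
      ≈⟨ ^-congˡ 3 (I-inverse m) ⟩
    1# ^ 3
      ≈⟨ solve 1 (λ x → con true :^ 3 := con true :^ 3 :+ con true :* con false :* (con true :* x)) refl (monic m) ⟩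
    1# ^ 3 + 1# * 0# * (1# * monic m) ∎
  ∑I³ (suc d) m = begin
    ∑lists (suc d) (λ l → I (l ++ m) ^ 3) * (E * (E + D d)) ^ 3
      ≈⟨ *-congʳ (∑lists-split d (_^ 3) m) ⟩
    (f₀ + f₁) * (E * (E + D d)) ^ 3
      ≈⟨ solve 4 (λ f₀ f₁ E w → (f₀ :+ f₁) :* (E :* (E :+ w)) :^ 3
           := (f₀ :* E :^ 3) :* (E :+ w) :^ 3 :+ (f₁ :* (E :+ w) :^ 3) :* E :^ 3) refl f₀ f₁ E (D d) ⟩
    (f₀ * E ^ 3) * (E + D d) ^ 3 + (f₁ * (E + D d) ^ 3) * E ^ 3
      ≈⟨ +-cong (*-congʳ eq₀) (*-congʳ eq₁) ⟩
    (c d ^ 3 + c d * b d * E) * (E + D d) ^ 3 + (c d ^ 3 + c d * b d * (E + D d)) * E ^ 3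
      ≈⟨ solve 4 (λ c b E w →
           (c :^ 3 :+ c :* b :* E) :* (E :+ w) :^ 3 :+ (c :^ 3 :+ c :* b :* (E :+ w)) :* E :^ 3
           := (c :* w) :^ 3 :+ c :* w :* (c :* c :+ w :* b) :* (E :* (E :+ w))) refl (c d) (b d) E (D d) ⟩
    c (suc d) ^ 3 + c (suc d) * b (suc d) * (E * (E + D d)) ∎
    where
    E f₀ f₁ : Carrier
    E  = e d (θ ^ suc d * monic m)
    f₀ = ∑lists d (λ l → I (l ++ false ∷ m) ^ 3)
    f₁ = ∑lists d (λ l → I (l ++ true ∷ m) ^ 3)
    eq₀ : f₀ * E ^ 3 ≈ c d ^ 3 + c d * b d * E
    eq₀ = trans (*-congˡ (^-congˡ 3 (sym (e-false∷ d m))))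
      (trans (∑I³ d (false ∷ m)) (+-congˡ (*-congˡ (e-false∷ d m))))
    eq₁ : f₁ * (E + D d) ^ 3 ≈ c d ^ 3 + c d * b d * (E + D d)
    eq₁ = trans (*-congˡ (^-congˡ 3 (sym (e-true∷ d m))))
      (trans (∑I³ d (true ∷ m)) (+-congˡ (*-congˡ (e-true∷ d m))))

  -- The values S_d(1) and S_d(3)

  D⁻¹ L ℓ : ℕ → Carrier
  D⁻¹ zero    = 1#
  D⁻¹ (suc d) = J (suc d) * (D⁻¹ d * D⁻¹ d)
  L zero    = 1#
  L (suc d) = br (suc d) * L d
  ℓ d = Sd d 1

  D⁻¹-inverse : ∀ d → D⁻¹ d * D d ≈ 1#
  D⁻¹-inverse zero    = *-identityˡ 1#
  D⁻¹-inverse (suc d) = begin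
    J (suc d) * (D⁻¹ d * D⁻¹ d) * D (suc d)
      ≈⟨ *-congˡ (D-suc d) ⟩
    J (suc d) * (D⁻¹ d * D⁻¹ d) * (br (suc d) * (D d * D d))
      ≈⟨ solve 4 (λ j i t w → j :* (i :* i) :* (t :* (w :* w)) := (j :* t) :* ((i :* w) :* (i :* w))) refl
           (J (suc d)) (D⁻¹ d) (br (suc d)) (D d) ⟩
    (J (suc d) * br (suc d)) * ((D⁻¹ d * D d) * (D⁻¹ d * D d))
      ≈⟨ *-cong (J-inverse d) (*-cong (D⁻¹-inverse d) (D⁻¹-inverse d)) ⟩
    1# * (1# * 1#)
      ≈⟨ solve 0 (con true :* (con true :* con true) := con true) refl ⟩
    1# ∎

  cancelD : ∀ d {x y} → x * D d ≈ y → x ≈ y * D⁻¹ d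
  cancelD d {x} {y} eq = begin
    x                    ≈⟨ *-identityʳ x ⟨
    x * 1#               ≈⟨ *-congˡ (D⁻¹-inverse d) ⟨
    x * (D⁻¹ d * D d)    ≈⟨ solve 3 (λ x i w → x :* (i :* w) := (x :* w) :* i) refl x (D⁻¹ d) (D d) ⟩
    (x * D d) * D⁻¹ d    ≈⟨ *-congʳ eq ⟩
    y * D⁻¹ d            ∎

  e-top : ∀ d → e d (θ ^ d * monic []) ≈ D d
  e-top d = e-cong d (*-identityʳ (θ ^ d))

  ℓ≈c/D : ∀ d → ℓ d ≈ c d * D⁻¹ d
  ℓ≈c/D d = cancelD d (begin
    ℓ d * D d
      ≈⟨ *-cong (∑lists-cong d (λ l → trans (*-identityʳ (I l)) (reflexive (≡.cong I (≡.sym (++-identityʳ l)))))) (sym (e-top d)) ⟩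
    ∑lists d (λ l → I (l ++ [])) * e d (θ ^ d * monic [])
      ≈⟨ ∑I d [] ⟩
    c d ∎)

  ℓ-0 : ℓ 0 ≈ 1#
  ℓ-0 = trans (ℓ≈c/D 0) (*-identityˡ 1#)

  ℓ-suc : ∀ d → ℓ (suc d) ≈ J (suc d) * ℓ d
  ℓ-suc d = begin
    ℓ (suc d)
      ≈⟨ ℓ≈c/D (suc d) ⟩
    c d * D d * (J (suc d) * (D⁻¹ d * D⁻¹ d))
      ≈⟨ solve 4 (λ c w j i → c :* w :* (j :* (i :* i)) := (i :* w) :* (j :* (c :* i))) refl (c d) (D d) (J (suc d)) (D⁻¹ d) ⟩
    (D⁻¹ d * D d) * (J (suc d) * (c d * D⁻¹ d))
      ≈⟨ *-cong (D⁻¹-inverse d) (*-congˡ (sym (ℓ≈c/D d))) ⟩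
    1# * (J (suc d) * ℓ d)
      ≈⟨ *-identityˡ (J (suc d) * ℓ d) ⟩
    J (suc d) * ℓ d ∎

  br*ℓ-suc : ∀ d → br (suc d) * ℓ (suc d) ≈ ℓ d
  br*ℓ-suc d = begin
    br (suc d) * ℓ (suc d)          ≈⟨ *-congˡ (ℓ-suc d) ⟩
    br (suc d) * (J (suc d) * ℓ d)  ≈⟨ solve 3 (λ t j l → t :* (j :* l) := (j :* t) :* l) refl (br (suc d)) (J (suc d)) (ℓ d) ⟩
    J (suc d) * br (suc d) * ℓ d    ≈⟨ *-congʳ (J-inverse d) ⟩
    1# * ℓ d                        ≈⟨ *-identityˡ (ℓ d) ⟩
    ℓ d                             ∎

  ℓ*L : ∀ d → ℓ d * L d ≈ 1#
  ℓ*L zero    = trans (*-identityʳ (ℓ 0)) ℓ-0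
  ℓ*L (suc d) = begin
    ℓ (suc d) * (br (suc d) * L d)   ≈⟨ solve 3 (λ l t m → l :* (t :* m) := (t :* l) :* m) refl (ℓ (suc d)) (br (suc d)) (L d) ⟩
    br (suc d) * ℓ (suc d) * L d     ≈⟨ *-congʳ (br*ℓ-suc d) ⟩
    ℓ d * L d                        ≈⟨ ℓ*L d ⟩
    1#                               ∎

  -- Dividing the recursion of `b` by that of `c` gives b_{d+1}/c_{d+1} = b_d/c_d + c_d/D_d, and the
  -- last term is `ℓ d`.
  b≈c*∑ℓ : ∀ d → b d ≈ c d * ∑ d ℓ
  b≈c*∑ℓ zero    = sym (zeroʳ 1#)
  b≈c*∑ℓ (suc d) = begin
    c d * c d + D d * b d
      ≈⟨ +-cong (sym (trans (*-congˡ (D⁻¹-inverse d)) (*-identityʳ (c d * c d)))) (*-congˡ (b≈c*∑ℓ d)) ⟩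
    c d * c d * (D⁻¹ d * D d) + D d * (c d * ∑ d ℓ)
      ≈⟨ solve 4 (λ c i w s → c :* c :* (i :* w) :+ w :* (c :* s) := c :* w :* (s :+ c :* i)) refl (c d) (D⁻¹ d) (D d) (∑ d ℓ) ⟩
    c d * D d * (∑ d ℓ + c d * D⁻¹ d)
      ≈⟨ *-congˡ (+-congˡ (ℓ≈c/D d)) ⟨
    c d * D d * (∑ d ℓ + ℓ d) ∎

  -- Divide `∑I³` at x = θ^d by D_d³. The mixed term yields the sum over f < d, and the cube of
  -- `ℓ d` supplies the summand f = d.
  Sd-3 : ∀ d → Sd d 3 ≈ ℓ d * ℓ d * ∑ (suc d) ℓ
  Sd-3 d = begin
    Sd d 3
      ≈⟨ cancelD d (cancelD d (cancelD d cubed)) ⟩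
    (c d ^ 3 + c d * b d * D d) * D⁻¹ d * D⁻¹ d * D⁻¹ d
      ≈⟨ solve 4 (λ c b w i → (c :^ 3 :+ c :* b :* w) :* i :* i :* i
           := (c :* i) :^ 3 :+ (c :* i) :* (b :* i) :* (i :* w)) refl (c d) (b d) (D d) (D⁻¹ d) ⟩
    (c d * D⁻¹ d) ^ 3 + (c d * D⁻¹ d) * (b d * D⁻¹ d) * (D⁻¹ d * D d)
      ≈⟨ +-cong (^-congˡ 3 (sym (ℓ≈c/D d)))
           (*-cong (*-cong (sym (ℓ≈c/D d)) (trans (*-congʳ (b≈c*∑ℓ d)) (trans
             (solve 3 (λ c s i → c :* s :* i := c :* i :* s) refl (c d) (∑ d ℓ) (D⁻¹ d))
             (*-congʳ (sym (ℓ≈c/D d)))))) (D⁻¹-inverse d)) ⟩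
    ℓ d ^ 3 + ℓ d * (ℓ d * ∑ d ℓ) * 1#
      ≈⟨ solve 2 (λ l s → l :^ 3 :+ l :* (l :* s) :* con true := l :* l :* (s :+ l)) refl (ℓ d) (∑ d ℓ) ⟩
    ℓ d * ℓ d * (∑ d ℓ + ℓ d) ∎
    where
    cubed : Sd d 3 * D d * D d * D d ≈ c d ^ 3 + c d * b d * D d
    cubed = begin
      Sd d 3 * D d * D d * D d
        ≈⟨ solve 2 (λ s w → s :* w :* w :* w := s :* w :^ 3) refl (Sd d 3) (D d) ⟩
      Sd d 3 * D d ^ 3
        ≈⟨ *-cong (∑lists-cong d (λ l → reflexive (≡.cong (λ l′ → I l′ ^ 3) (≡.sym (++-identityʳ l)))))
                  (^-congˡ 3 (sym (e-top d))) ⟩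
      ∑lists d (λ l → I (l ++ []) ^ 3) * e d (θ ^ d * monic []) ^ 3
        ≈⟨ ∑I³ d [] ⟩
      c d ^ 3 + c d * b d * e d (θ ^ d * monic [])
        ≈⟨ +-congˡ (*-congˡ (e-top d)) ⟩
      c d ^ 3 + c d * b d * D d ∎

  ∑ℓ*br1 : ∀ d → ∑ (suc d) ℓ * br 1 ≈ br (suc d) * ℓ d
  ∑ℓ*br1 zero    = solve 2 (λ l t → (con false :+ l) :* t := t :* l) refl (ℓ 0) (br 1)
  ∑ℓ*br1 (suc d) = begin
    (∑ (suc d) ℓ + ℓ (suc d)) * br 1
      ≈⟨ distribʳ (br 1) (∑ (suc d) ℓ) (ℓ (suc d)) ⟩
    ∑ (suc d) ℓ * br 1 + ℓ (suc d) * br 1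
      ≈⟨ +-congʳ (trans (∑ℓ*br1 d) (*-congˡ (sym (br*ℓ-suc d)))) ⟩
    br (suc d) * (br (suc d) * ℓ (suc d)) + ℓ (suc d) * br 1
      -- This is [d+1]² + [1] = [d+2].
      ≈⟨ solve 3 (λ t θ l → (t :+ θ) :* ((t :+ θ) :* l) :+ l :* (θ :* θ :+ θ) := (t :* t :+ θ) :* l) refl
           (θ ^2^ suc d) θ (ℓ (suc d)) ⟩
    br (suc (suc d)) * ℓ (suc d) ∎

  -- Closed forms of the truncated sums

  ^2^-^2^ : ∀ x m n → (x ^2^ m) ^2^ n ≈ x ^2^ (n ℕ.+ m)
  ^2^-^2^ x m zero    = refl
  ^2^-^2^ x m (suc n) = *-cong (^2^-^2^ x m n) (^2^-^2^ x m n)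

  br-^2^ : ∀ m n → br m ^2^ n ≈ θ ^2^ (m ℕ.+ n) + θ ^2^ n
  br-^2^ m n = trans (^2^-+ n (θ ^2^ m) θ)
    (+-congʳ (trans (^2^-^2^ θ m n) (reflexive (≡.cong (θ ^2^_) (ℕ.+-comm n m)))))

  -- The tuple (1, 2, ..., 2^{r-1}) with its tail written as a doubled tuple, so that `Z<-double`
  -- makes the inner sum a square.
  pows : ℕ → List ℕ
  pows zero    = []
  pows (suc r) = 1 ∷ map (2 ℕ.*_) (pows r)

  Z<pows-suc : ∀ r n → Z< (pows (suc r)) (suc n) ≈ Z< (pows (suc r)) n + ℓ n * (Z< (pows r) n * Z< (pows r) n)
  Z<pows-suc r n = +-congˡ (*-congˡ (Z<-double (pows r) n))

  -- There is no room for r strictly decreasing degrees below n.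
  Z<pows-zero : ∀ r n → n ℕ.< r → Z< (pows r) n ≈ 0#
  Z<pows-zero (suc r) zero    _         = refl
  Z<pows-zero (suc r) (suc n) (s≤s n<r) = begin
    Z< (pows (suc r)) (suc n)
      ≈⟨ Z<pows-suc r n ⟩
    Z< (pows (suc r)) n + ℓ n * (Z< (pows r) n * Z< (pows r) n)
      ≈⟨ +-cong (Z<pows-zero (suc r) n (ℕ.m<n⇒m<1+n n<r))
                (*-congˡ (*-cong (Z<pows-zero r n n<r) (Z<pows-zero r n n<r))) ⟩
    0# + ℓ n * (0# * 0#)
      ≈⟨ solve 1 (λ l → con false :+ l :* (con false :* con false) := con false) refl (ℓ n) ⟩
    0# ∎

  -- Induction on r and m. After common factors are removed, the step is [m+1]^{2^{r+1}} + [r+1] =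
  -- [m+r+2]: the powers θ^{2^{r+1}}, called `Q` below, cancel.
  Z<pows : ∀ r m → Z< (pows r) (m ℕ.+ r) ≈ L (m ℕ.+ r) * (D⁻¹ r * ℓ m ^2^ r)
  Z<pows zero    m       rewrite ℕ.+-identityʳ m = sym (trans
    (solve 2 (λ L l → L :* (con true :* l) := l :* L) refl (L m) (ℓ m)) (ℓ*L m))
  Z<pows (suc r) zero    = begin
    Z< (pows (suc r)) (suc r)
      ≈⟨ Z<pows-suc r r ⟩
    Z< (pows (suc r)) r + ℓ r * (Z< (pows r) r * Z< (pows r) r)
      ≈⟨ +-cong (Z<pows-zero (suc r) r ℕ.≤-refl) (*-congˡ (*-cong (Z<pows r 0) (Z<pows r 0))) ⟩
    0# + ℓ r * ((L r * (D⁻¹ r * x)) * (L r * (D⁻¹ r * x)))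
      -- A factor 1 is inserted here to become `J (suc r) * br (suc r)`: its first half completes
      -- `D⁻¹ (suc r)`, its second half completes `L (suc r)`.
      ≈⟨ solve 4 (λ l L i x → con false :+ l :* ((L :* (i :* x)) :* (L :* (i :* x)))
           := (l :* L) :* (con true :* (L :* ((i :* i) :* (x :* x))))) refl (ℓ r) (L r) (D⁻¹ r) x ⟩
    (ℓ r * L r) * (1# * (L r * ((D⁻¹ r * D⁻¹ r) * (x * x))))
      ≈⟨ *-cong (ℓ*L r) (*-congʳ (sym (J-inverse r))) ⟩
    1# * (J (suc r) * br (suc r) * (L r * ((D⁻¹ r * D⁻¹ r) * (x * x))))
      ≈⟨ solve 5 (λ j t L i x → con true :* (j :* t :* (L :* (i :* x)))
           := (t :* L) :* ((j :* i) :* x)) refl (J (suc r)) (br (suc r)) (L r) (D⁻¹ r * D⁻¹ r) (x * x) ⟩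
    (br (suc r) * L r) * (D⁻¹ (suc r) * (x * x)) ∎
    where
    x : Carrier
    x = ℓ 0 ^2^ r
  Z<pows (suc r) (suc m) = begin
    Z< (pows (suc r)) (suc n)
      ≈⟨ Z<pows-suc r n ⟩
    Z< (pows (suc r)) n + ℓ n * (Z< (pows r) n * Z< (pows r) n)
      ≈⟨ +-cong (trans (Z<pows (suc r) m) (*-congˡ (*-congˡ ℓm))) (*-congˡ (*-cong prev prev)) ⟩
    L n * (D⁻¹ (suc r) * ((P + Q) * (x * x))) + ℓ n * ((L n * (D⁻¹ r * x)) * (L n * (D⁻¹ r * x)))
      ≈⟨ solve 7 (λ l L j i x P Q →
           L :* ((j :* (i :* i)) :* ((P :+ Q) :* (x :* x))) :+ l :* ((L :* (i :* x)) :* (L :* (i :* x)))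
           := L :* ((j :* (i :* i)) :* ((P :+ Q) :* (x :* x))) :+ (l :* L) :* con true :* (L :* ((i :* i) :* (x :* x))))
           refl (ℓ n) (L n) (J (suc r)) (D⁻¹ r) x P Q ⟩
    L n * (D⁻¹ (suc r) * ((P + Q) * (x * x))) + (ℓ n * L n) * 1# * (L n * ((D⁻¹ r * D⁻¹ r) * (x * x)))
      ≈⟨ +-congˡ (*-congʳ (*-cong (ℓ*L n) (sym (J-inverse r)))) ⟩
    L n * (D⁻¹ (suc r) * ((P + Q) * (x * x))) + 1# * (J (suc r) * (Q + θ)) * (L n * ((D⁻¹ r * D⁻¹ r) * (x * x)))
      ≈⟨ solve 7 (λ θ L j i x P Q →
           L :* ((j :* i) :* ((P :+ Q) :* x)) :+ con true :* (j :* (Q :+ θ)) :* (L :* (i :* x))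
           := ((P :+ θ) :* L) :* ((j :* i) :* x))
           refl θ (L n) (J (suc r)) (D⁻¹ r * D⁻¹ r) (x * x) P Q ⟩
    (br (suc n) * L n) * (D⁻¹ (suc r) * (x * x)) ∎
    where
    n : ℕ
    n = m ℕ.+ suc r
    x P Q : Carrier
    x = ℓ (suc m) ^2^ r
    P = θ ^2^ suc n
    Q = θ ^2^ suc r
    prev : Z< (pows r) n ≈ L n * (D⁻¹ r * x)
    prev rewrite ℕ.+-suc m r = Z<pows r (suc m)
    ℓm : ℓ m ^2^ suc r ≈ (P + Q) * (x * x)
    ℓm = begin
      ℓ m ^2^ suc r                                ≈⟨ ^2^-cong (suc r) (sym (br*ℓ-suc m)) ⟩
      (br (suc m) * ℓ (suc m)) ^2^ suc r           ≈⟨ ^2^-* (suc r) (br (suc m)) (ℓ (suc m)) ⟩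
      br (suc m) ^2^ suc r * ℓ (suc m) ^2^ suc r   ≈⟨ *-congʳ (br-^2^ (suc m) (suc r)) ⟩
      (P + Q) * (x * x)                            ∎

  Sd-2^ : ∀ r d → Sd d (2 ℕ.^ r) ≈ ℓ d ^2^ r
  Sd-2^ zero    d = refl
  Sd-2^ (suc r) d = trans (Sd-double d (2 ℕ.^ r)) (*-cong (Sd-2^ r d) (Sd-2^ r d))

  Z<2^ : ∀ r n → Z< (2 ℕ.^ r ∷ []) n ≈ ∑ n ℓ ^2^ r
  Z<2^ zero    n = ∑-cong n (λ d → *-identityʳ (ℓ d))
  Z<2^ (suc r) n = trans (Z<-double (2 ℕ.^ r ∷ []) n) (*-cong (Z<2^ r n) (Z<2^ r n))

  -- In the summand with d₁ = m + r, the factor `ℓ (m + r)` cancels the `L (m + r)` of `Z<pows`, and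
  -- S_m(2^r)/D_r remains.
  Z<1∷pows : ∀ r m → Z< (1 ∷ pows r) (m ℕ.+ r) ≈ D⁻¹ r * Z< (2 ℕ.^ r ∷ []) m
  Z<1∷pows r zero    = trans
    (∑-zero r (λ d d<r → trans (*-congˡ (Z<pows-zero r d d<r)) (zeroʳ (ℓ d))))
    (sym (zeroʳ (D⁻¹ r)))
  Z<1∷pows r (suc m) = begin
    Z< (1 ∷ pows r) n + ℓ n * Z< (pows r) n
      ≈⟨ +-cong (Z<1∷pows r m) (*-congˡ (Z<pows r m)) ⟩
    D⁻¹ r * z + ℓ n * (L n * (D⁻¹ r * ℓ m ^2^ r))
      ≈⟨ +-congˡ (*-assoc (ℓ n) (L n) (D⁻¹ r * ℓ m ^2^ r)) ⟨
    D⁻¹ r * z + ℓ n * L n * (D⁻¹ r * ℓ m ^2^ r)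
      ≈⟨ +-congˡ (*-cong (ℓ*L n) (*-congˡ (sym (Sd-2^ r m)))) ⟩
    D⁻¹ r * z + 1# * (D⁻¹ r * Sd m (2 ℕ.^ r))
      ≈⟨ solve 3 (λ i z s → i :* z :+ con true :* (i :* s) := i :* (z :+ s :* con true)) refl
           (D⁻¹ r) z (Sd m (2 ℕ.^ r)) ⟩
    D⁻¹ r * (z + Sd m (2 ℕ.^ r) * 1#) ∎
    where
    n : ℕ
    n = m ℕ.+ r
    z : Carrier
    z = Z< (2 ℕ.^ r ∷ []) m

  -- Since S_d(3) = S_d(1)² ∑_{f ≤ d} S_f(1), the off-diagonal part of the product
  -- ζ(1) ζ(1, 2, ss) collapses, in characteristic 2, to ζ(1, 3, ss).
  off-diagonal : ∀ ss n →
    ∑ n ℓ * Z< (2 ∷ ss) n + Z< (1 ∷ 2 ∷ ss) n ≈ Z< (3 ∷ ss) n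
  off-diagonal ss zero    = solve 0 (con false :* con false :+ con false := con false) refl
  off-diagonal ss (suc n) = begin
    (∑ n ℓ + ℓ n) * (V + Sd n 2 * W) + (B + ℓ n * V)
      ≈⟨ solve 6 (λ a l V s W B → (a :+ l) :* (V :+ s :* W) :+ (B :+ l :* V)
           := (a :* V :+ B) :+ s :* (a :+ l) :* W) refl (∑ n ℓ) (ℓ n) V (Sd n 2) W B ⟩
    (∑ n ℓ * V + B) + Sd n 2 * (∑ n ℓ + ℓ n) * W
      ≈⟨ +-cong (off-diagonal ss n) (*-congʳ (trans (*-congʳ (Sd-2^ 1 n)) (sym (Sd-3 n)))) ⟩
    Z< (3 ∷ ss) n + Sd n 3 * W ∎
    where
    V W B : Carrier
    V = Z< (2 ∷ ss) n
    W = Z< ss n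
    B = Z< (1 ∷ 2 ∷ ss) n

  -- Raising the truncation by one adds `ℓ n` times the left side of `off-diagonal`, and the
  -- diagonal term with ℓ_n² = S_n(2), which builds up the sum for (2, 2, ss).
  Z<-product : ∀ ss n →
    ∑ n ℓ * Z< (1 ∷ 2 ∷ ss) n ≈ Z< (1 ∷ 3 ∷ ss) n + Z< (2 ∷ 2 ∷ ss) n
  Z<-product ss zero    = solve 0 (con false :* con false := con false :+ con false) refl
  Z<-product ss (suc n) = begin
    (∑ n ℓ + ℓ n) * (B + ℓ n * V)
      ≈⟨ solve 4 (λ a l B V → (a :+ l) :* (B :+ l :* V) := a :* B :+ (l :* (a :* V :+ B) :+ (l :* l) :* V)) refl
           (∑ n ℓ) (ℓ n) B V ⟩
    ∑ n ℓ * B + (ℓ n * (∑ n ℓ * V + B) + (ℓ n * ℓ n) * V)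
      ≈⟨ +-cong (Z<-product ss n) (+-cong (*-congˡ (off-diagonal ss n)) (*-congʳ (sym (Sd-2^ 1 n)))) ⟩
    (X + Y) + (ℓ n * Z< (3 ∷ ss) n + Sd n 2 * V)
      ≈⟨ solve 4 (λ X Y p q → (X :+ Y) :+ (p :+ q) := (X :+ p) :+ (Y :+ q)) refl
           X Y (ℓ n * Z< (3 ∷ ss) n) (Sd n 2 * V) ⟩
    (X + ℓ n * Z< (3 ∷ ss) n) + (Y + Sd n 2 * V) ∎
    where
    V B X Y : Carrier
    V = Z< (2 ∷ ss) n
    B = Z< (1 ∷ 2 ∷ ss) n
    X = Z< (1 ∷ 3 ∷ ss) n
    Y = Z< (2 ∷ 2 ∷ ss) n

  -- Limits in the u-adic topology

  Small-resp : ∀ N {x y} → x ≈ y → Small N x → Small N y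
  Small-resp N x≈y (z , iz , x≈) = z , iz , trans (sym x≈y) x≈

  Small-+ : ∀ N {x y} → Small N x → Small N y → Small N (x + y)
  Small-+ N (x′ , ix , x≈) (y′ , iy , y≈) =
    x′ + y′ , Integral-+ ix iy , trans (+-cong x≈ y≈) (sym (distribˡ (u ^ N) x′ y′))

  -- A pole of order at most k in the fixed factor costs k digits of precision.
  Small-*ˡ : ∀ N x → ∃ λ M → ∀ {y} → Small M y → Small N (x * y)
  Small-*ˡ N x with denominator x
  ... | k , ix = N ℕ.+ k , λ { {y} (y′ , iy , y≈) → (u ^ k * x) * y′ , Integral-* ix iy , (begin
    x * y                        ≈⟨ *-congˡ y≈ ⟩
    x * (u ^ (N ℕ.+ k) * y′)     ≈⟨ *-congˡ (*-congʳ (^-homo-* u N k)) ⟩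
    x * (u ^ N * u ^ k * y′)     ≈⟨ solve 4 (λ x p q y → x :* (p :* q :* y) := p :* ((q :* x) :* y)) refl x (u ^ N) (u ^ k) y′ ⟩
    u ^ N * ((u ^ k * x) * y′)   ∎) }

  Integral-u^ : ∀ n → Integral (u ^ n)
  Integral-u^ zero    = Integral-1
  Integral-u^ (suc n) = Integral-* Integral-u (Integral-u^ n)

  Small⇒Integral : ∀ N {x} → Small N x → Integral x
  Small⇒Integral N (y , iy , x≈) = Integral-resp (sym x≈) (Integral-* (Integral-u^ N) iy)

  Small-*-Integral : ∀ N {x y} → Small N x → Integral y → Small N (x * y)
  Small-*-Integral N {x} {y} (x′ , ix , x≈) iy =
    x′ * y , Integral-* ix iy , trans (*-congʳ x≈) (*-assoc (u ^ N) x′ y)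

  Small-anti : ∀ {M N x} → M ℕ.≤ N → Small N x → Small M x
  Small-anti {M} {N} {x} M≤N (y , iy , x≈) =
    u ^ (N ℕ.∸ M) * y , Integral-* (Integral-u^ (N ℕ.∸ M)) iy , (begin
      x                              ≈⟨ x≈ ⟩
      u ^ N * y                      ≈⟨ *-congʳ (^-congʳ u (ℕ.m+[n∸m]≡n M≤N)) ⟨
      u ^ (M ℕ.+ (N ℕ.∸ M)) * y      ≈⟨ *-congʳ (^-homo-* u M (N ℕ.∸ M)) ⟩
      u ^ M * u ^ (N ℕ.∸ M) * y      ≈⟨ *-assoc (u ^ M) (u ^ (N ℕ.∸ M)) y ⟩
      u ^ M * (u ^ (N ℕ.∸ M) * y)    ∎)

  infix 4 _⟶_
  _⟶_ : (ℕ → Carrier) → Carrier → Set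
  a ⟶ x = ∀ N → ∃ λ n₀ → ∀ n → n₀ ℕ.≤ n → Small N (a n + x)

  ⟶-resp : ∀ {a b x y} → (∀ n → a n ≈ b n) → x ≈ y → a ⟶ x → b ⟶ y
  ⟶-resp a≈b x≈y a⟶x N with a⟶x N
  ... | n₀ , small = n₀ , λ n n₀≤n → Small-resp N (+-cong (a≈b n) x≈y) (small n n₀≤n)

  ⟶-unique : ∀ {a x y} → a ⟶ x → a ⟶ y → x ≈ y
  ⟶-unique {a} {x} {y} a⟶x a⟶y = begin
    x            ≈⟨ solve 2 (λ x y → x := (x :+ y) :+ y) refl x y ⟩
    (x + y) + y  ≈⟨ +-congʳ (separated small) ⟩
    0# + y       ≈⟨ +-identityˡ y ⟩
    y            ∎
    where
    small : ∀ N → Small N (x + y)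
    small N with a⟶x N | a⟶y N
    ... | p , xs | q , ys = Small-resp N
      (solve 3 (λ a x y → (a :+ x) :+ (a :+ y) := x :+ y) refl (a (p ℕ.⊔ q)) x y)
      (Small-+ N (xs (p ℕ.⊔ q) (ℕ.m≤m⊔n p q)) (ys (p ℕ.⊔ q) (ℕ.m≤n⊔m p q)))

  ⟶-const : ∀ x → (λ _ → x) ⟶ x
  ⟶-const x N = 0 , λ _ _ → 0# , Integral-0 , trans (x+x≈0 x) (sym (zeroʳ (u ^ N)))

  ⟶-+ : ∀ {a b x y} → a ⟶ x → b ⟶ y → (λ n → a n + b n) ⟶ x + y
  ⟶-+ {a} {b} {x} {y} a⟶x b⟶y N with a⟶x N | b⟶y N
  ... | p , xs | q , ys = p ℕ.⊔ q , λ n pq≤n → Small-resp N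
    (solve 4 (λ a b x y → (a :+ x) :+ (b :+ y) := (a :+ b) :+ (x :+ y)) refl (a n) (b n) x y)
    (Small-+ N (xs n (ℕ.m⊔n≤o⇒m≤o p q pq≤n)) (ys n (ℕ.m⊔n≤o⇒n≤o p q pq≤n)))

  ⟶-* : ∀ {a b x y} → a ⟶ x → b ⟶ y → (λ n → a n * b n) ⟶ x * y
  ⟶-* {a} {b} {x} {y} a⟶x b⟶y N with Small-*ˡ N x | Small-*ˡ N y
  -- The error is (a + x)(b + y) + x(b + y) + y(a + x). Precision 0 for `b` makes b + y integral,
  -- which is enough in the first product.
  ... | M , Mx | M′ , My with a⟶x N | a⟶x M′ | b⟶y 0 | b⟶y M
  ... | p , xs | p′ , xs′ | q , ys | q′ , ys′ =
    (p ℕ.⊔ p′) ℕ.⊔ (q ℕ.⊔ q′) , λ n n₀≤n →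
      let pp′≤n = ℕ.m⊔n≤o⇒m≤o (p ℕ.⊔ p′) (q ℕ.⊔ q′) n₀≤n
          qq′≤n = ℕ.m⊔n≤o⇒n≤o (p ℕ.⊔ p′) (q ℕ.⊔ q′) n₀≤n
      in Small-resp N
           (solve 4 (λ a b x y → (a :+ x) :* (b :+ y) :+ (x :* (b :+ y) :+ y :* (a :+ x)) := a :* b :+ x :* y) refl (a n) (b n) x y)
           (Small-+ N
             (Small-*-Integral N (xs n (ℕ.m⊔n≤o⇒m≤o p p′ pp′≤n)) (Small⇒Integral 0 (ys n (ℕ.m⊔n≤o⇒m≤o q q′ qq′≤n))))
             (Small-+ N (Mx (ys′ n (ℕ.m⊔n≤o⇒n≤o q q′ qq′≤n))) (My (xs′ n (ℕ.m⊔n≤o⇒n≤o p p′ pp′≤n)))))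

  ⟶-^2^ : ∀ k {a x} → a ⟶ x → (λ n → a n ^2^ k) ⟶ x ^2^ k
  ⟶-^2^ zero    a⟶x = a⟶x
  ⟶-^2^ (suc k) a⟶x = ⟶-* (⟶-^2^ k a⟶x) (⟶-^2^ k a⟶x)

  ⟶-shift : ∀ k {a x} → a ⟶ x → (λ n → a (n ℕ.+ k)) ⟶ x
  ⟶-shift k a⟶x N with a⟶x N
  ... | n₀ , small = n₀ , λ n n₀≤n → small (n ℕ.+ k) (ℕ.≤-trans n₀≤n (ℕ.m≤m+n n k))

  -- Convergence of the sums and products

  -- The slack `N` absorbs the unit of length lost when the recursion of `∑lists` splits off a head.
  ∑lists-small : ∀ N d {h} → (∀ l → Small (length l ℕ.+ N) (h l)) → Small (d ℕ.+ N) (∑lists d h)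
  ∑lists-small N zero    h-small = h-small []
  ∑lists-small N (suc d) {h} h-small = ≡.subst (λ k → Small k (∑lists (suc d) h)) (ℕ.+-suc d N)
    (∑lists-small (suc N) d (λ l → ≡.subst (λ k → Small k (h (false ∷ l) + h (true ∷ l)))
      (≡.sym (ℕ.+-suc (length l) N)) (Small-+ (suc (length l ℕ.+ N)) (h-small (false ∷ l)) (h-small (true ∷ l)))))

  Integral-^ : ∀ s {x} → Integral x → Integral (x ^ s)
  Integral-^ zero    ix = Integral-1
  Integral-^ (suc s) ix = Integral-* ix (Integral-^ s ix)

  Sd-small : ∀ d s → Small d (Sd d (suc s))
  Sd-small d s = ≡.subst (λ k → Small k (Sd d (suc s))) (ℕ.+-identityʳ d) (∑lists-small 0 d (λ l →
    ≡.subst (λ k → Small k (I l ^ suc s)) (≡.sym (ℕ.+-identityʳ (length l)))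
      (Small-*-Integral (length l) (I-small l) (Integral-^ s (Small⇒Integral (length l) (I-small l))))))

  ℓ⟶0 : ℓ ⟶ 0#
  ℓ⟶0 N = N , λ n N≤n → Small-anti N≤n (Small-resp n (sym (+-identityʳ (ℓ n))) (Sd-small n 0))

  Integral-∑ : ∀ n {h} → (∀ i → Integral (h i)) → Integral (∑ n h)
  Integral-∑ zero    ih = Integral-0
  Integral-∑ (suc n) ih = Integral-+ (Integral-∑ n ih) (ih n)

  Integral-∏ : ∀ n {h} → (∀ i → Integral (h i)) → Integral (∏ n h)
  Integral-∏ zero    ih = Integral-1
  Integral-∏ (suc n) ih = Integral-* (Integral-∏ n ih) (ih n)

  Integral-Sd : ∀ d s → Integral (Sd d s)
  Integral-Sd d s = go d (λ l → Integral-^ s (Small⇒Integral (length l) (I-small l)))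
    where
    go : ∀ d {h} → (∀ l → Integral (h l)) → Integral (∑lists d h)
    go zero    ih = ih []
    go (suc d) ih = go d (λ l → Integral-+ (ih (false ∷ l)) (ih (true ∷ l)))

  Integral-Z< : ∀ ss n → Integral (Z< ss n)
  Integral-Z< []       n = Integral-1
  Integral-Z< (s ∷ ss) n = Integral-∑ n (λ d → Integral-* (Integral-Sd d s) (Integral-Z< ss d))

  -- The modulus is the identity: this is the rate at which coefficient n is final from the partial
  -- sum of index n + 1 on, as the definition of `ζA` presupposes.
  Cauchy : (ℕ → Carrier) → Set
  Cauchy a = ∀ {N n} → N ℕ.≤ n → Small N (a n + a N)

  steps⇒Cauchy : ∀ {a} → (∀ n → Small n (a (suc n) + a n)) → Cauchy a
  steps⇒Cauchy {a} step {N} N≤n = go (ℕ.≤⇒≤′ N≤n)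
    where
    go : ∀ {n} → N ℕ.≤′ n → Small N (a n + a N)
    go (ℕ.≤′-reflexive ≡.refl) = proj₂ (⟶-const (a N) N) 0 z≤n
    go (ℕ.≤′-step {n} N≤′n)    = Small-resp N
      (solve 3 (λ x y z → (x :+ y) :+ (y :+ z) := x :+ z) refl (a (suc n)) (a n) (a N))
      (Small-+ N (Small-anti (ℕ.≤′⇒≤ N≤′n) (step n)) (go N≤′n))

  Z<-Cauchy : ∀ s ss → 0 ℕ.< s → Cauchy (Z< (s ∷ ss))
  Z<-Cauchy (suc s) ss _ = steps⇒Cauchy (λ n → Small-resp n
    (solve 2 (λ x y → y := (x :+ y) :+ x) refl (Z< (suc s ∷ ss) n) (Sd n (suc s) * Z< ss n))
    (Small-*-Integral n (Sd-small n s) (Integral-Z< ss n)))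

  ∏-Cauchy : ∀ h → (∀ i → Integral (h i)) → (∀ i → Small i (h i + 1#)) → Cauchy (λ n → ∏ n h)
  ∏-Cauchy h ih h≈1 = steps⇒Cauchy (λ n → Small-resp n
    (solve 2 (λ p x → (x :+ con true) :* p := p :* x :+ p) refl (∏ n h) (h n))
    (Small-*-Integral n (h≈1 n) (Integral-∏ n ih)))

  foldr-applyUpTo-∑ : ∀ h n → foldr _+_ 0# (applyUpTo h n) ≈ ∑ n h
  foldr-applyUpTo-∑ h zero    = refl
  foldr-applyUpTo-∑ h (suc n) = trans (+-congˡ (foldr-applyUpTo-∑ (λ i → h (suc i)) n)) (sym (∑-head n h))
    where
    ∑-head : ∀ n h → ∑ (suc n) h ≈ h 0 + ∑ n (λ i → h (suc i))
    ∑-head zero    h = +-comm 0# (h 0)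
    ∑-head (suc n) h = trans (+-congʳ (∑-head n h)) (+-assoc (h 0) _ _)

  foldr-applyUpTo-∏ : ∀ h n → foldr _*_ 1# (applyUpTo h n) ≈ ∏ n h
  foldr-applyUpTo-∏ h zero    = refl
  foldr-applyUpTo-∏ h (suc n) = trans (*-congˡ (foldr-applyUpTo-∏ (λ i → h (suc i)) n)) (sym (∏-head n h))
    where
    ∏-head : ∀ n h → ∏ (suc n) h ≈ h 0 * ∏ n (λ i → h (suc i))
    ∏-head zero    h = *-comm 1# (h 0)
    ∏-head (suc n) h = trans (*-congʳ (∏-head n h)) (*-assoc (h 0) _ _)

  0^2^ : ∀ k → 0# ^2^ k ≈ 0#
  0^2^ zero    = refl
  0^2^ (suc k) = trans (*-congʳ (0^2^ k)) (zeroˡ _)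

  J1-cancel : ∀ {x y} → x * br 1 ≈ y → x ≈ y * J 1
  J1-cancel {x} {y} eq = begin
    x                  ≈⟨ *-identityʳ x ⟨
    x * 1#             ≈⟨ *-congˡ (J-inverse 0) ⟨
    x * (J 1 * br 1)   ≈⟨ solve 3 (λ x j t → x :* (j :* t) := (x :* t) :* j) refl x (J 1) (br 1) ⟩
    x * br 1 * J 1     ≈⟨ *-congʳ eq ⟩
    y * J 1            ∎

  -- Bracket identities for the evaluation

  ∏J : ℕ → ℕ → Carrier
  ∏J s k = ∏ k (λ j → J (suc j) ^ (2 ℕ.^ ((s ℕ.+ k) ℕ.∸ suc j)))

  -- D_k is the product of the [j]^{2^{k-j}} over 1 ≤ j ≤ k. The theorem uses s = 2, but s stays
  -- free because removing the last factor turns (s, k + 1) into (s + 1, k).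
  ∏J≈D⁻¹ : ∀ s k → ∏J s k ≈ D⁻¹ k ^2^ s
  ∏J≈D⁻¹ s zero    = sym (^2^-1 s)
  ∏J≈D⁻¹ s (suc k) = begin
    ∏ k (λ j → J (suc j) ^ (2 ℕ.^ ((s ℕ.+ suc k) ℕ.∸ suc j))) * J (suc k) ^ (2 ℕ.^ ((s ℕ.+ suc k) ℕ.∸ suc k))
      ≈⟨ *-cong init (trans (^-congʳ (J (suc k)) (≡.cong (2 ℕ.^_) (ℕ.m+n∸n≡m s (suc k)))) (^≈^2^ (J (suc k)) s)) ⟩
    D⁻¹ k ^2^ suc s * J (suc k) ^2^ s
      ≈⟨ *-comm _ _ ⟩
    J (suc k) ^2^ s * D⁻¹ k ^2^ suc s
      ≈⟨ *-congˡ (^2^-* s (D⁻¹ k) (D⁻¹ k)) ⟨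
    J (suc k) ^2^ s * (D⁻¹ k * D⁻¹ k) ^2^ s
      ≈⟨ ^2^-* s (J (suc k)) (D⁻¹ k * D⁻¹ k) ⟨
    (J (suc k) * (D⁻¹ k * D⁻¹ k)) ^2^ s ∎
    where
    init : ∏ k (λ j → J (suc j) ^ (2 ℕ.^ ((s ℕ.+ suc k) ℕ.∸ suc j))) ≈ D⁻¹ k ^2^ suc s
    init rewrite ℕ.+-suc s k = ∏J≈D⁻¹ (suc s) k

  -- The origin of the numerator [r] - 1, for r = k + 2. The left side is what the two terms of the
  -- evaluation leave over the common denominator [1][r]; the square of [r-1] on the right cancels
  -- against D_{r-1}².
  bracket-identity : ∀ k → br 1 ^2^ suc (suc k) + br 1 * br (suc (suc k))
                         ≈ (br (suc (suc k)) + 1#) * (br (suc k) * br (suc k))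
  bracket-identity k = begin
    br 1 ^2^ suc (suc k) + br 1 * br (suc (suc k))
      ≈⟨ +-congʳ (br-^2^ 1 (suc (suc k))) ⟩
    ((t * t) * (t * t) + t * t) + br 1 * br (suc (suc k))
      ≈⟨ solve 2 (λ t θ → ((t :* t) :* (t :* t) :+ t :* t) :+ (θ :* θ :+ θ) :* (t :* t :+ θ)
           := ((t :* t :+ θ) :+ con true) :* ((t :+ θ) :* (t :+ θ))) refl t θ ⟩
    (br (suc (suc k)) + 1#) * (br (suc k) * br (suc k)) ∎
    where
    t : Carrier
    t = θ ^2^ suc k

  -- With v = θ^{1-2^i} and i = j + 1, expanding the fraction 1/(1 - v) by θ^{2^i} turns its
  -- denominator into [i].
  geometric≈ : ∀ j {w v} → w * (1# + v) ≈ 1# → θ ^2^ suc j * v ≈ θ → w ≈ θ ^2^ suc j * J (suc j)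
  geometric≈ j {w} {v} w-inverse v≈ = begin
    w                                        ≈⟨ *-identityʳ w ⟨
    w * 1#                                   ≈⟨ *-congˡ (J-inverse j) ⟨
    w * (J (suc j) * (t + θ))                ≈⟨ *-congˡ (*-congˡ (+-congˡ v≈)) ⟨
    w * (J (suc j) * (t + t * v))            ≈⟨ solve 4 (λ w i t v → w :* (i :* (t :+ t :* v)) := (w :* (con true :+ v)) :* (t :* i)) refl w (J (suc j)) t v ⟩
    (w * (1# + v)) * (t * J (suc j))         ≈⟨ *-congʳ w-inverse ⟩
    1# * (t * J (suc j))                     ≈⟨ *-identityˡ (t * J (suc j)) ⟩
    t * J (suc j)                            ∎
    where
    t : Carrier
    t = θ ^2^ suc j

  -- Identities between the limits

  module Zeta
    (ζ : List ℕ → Carrier) (Z<⟶ζ : ∀ s ss → 0 ℕ.< s → Z< (s ∷ ss) ⟶ ζ (s ∷ ss)) where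

    z : Carrier
    z = ζ (1 ∷ [])

    0<2^ : ∀ r → 0 ℕ.< 2 ℕ.^ r
    0<2^ r = ℕ.>-nonZero⁻¹ (2 ℕ.^ r) ⦃ ℕ.m^n≢0 2 r ⦄

    ∑ℓ⟶z : (λ n → ∑ n ℓ) ⟶ z
    ∑ℓ⟶z = ⟶-resp (Z<2^ 0) refl (Z<⟶ζ 1 [] (s≤s z≤n))

    ζ-2^ : ∀ r → ζ (2 ℕ.^ r ∷ []) ≈ z ^2^ r
    ζ-2^ r = ⟶-unique (⟶-resp (Z<2^ r) refl (Z<⟶ζ (2 ℕ.^ r) [] (0<2^ r))) (⟶-^2^ r ∑ℓ⟶z)

    ζ-product : ∀ ss → z * ζ (1 ∷ 2 ∷ ss) ≈ ζ (1 ∷ 3 ∷ ss) + ζ (2 ∷ 2 ∷ ss)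
    ζ-product ss = ⟶-unique
      (⟶-resp (Z<-product ss) refl (⟶-* ∑ℓ⟶z (Z<⟶ζ 1 (2 ∷ ss) (s≤s z≤n))))
      (⟶-+ (Z<⟶ζ 1 (3 ∷ ss) (s≤s z≤n)) (Z<⟶ζ 2 (2 ∷ ss) (s≤s z≤n)))

    ζ-double : ∀ s ss → 0 ℕ.< s → ζ (map (2 ℕ.*_) (s ∷ ss)) ≈ ζ (s ∷ ss) * ζ (s ∷ ss)
    ζ-double s ss 0<s = ⟶-unique
      (⟶-resp (Z<-double (s ∷ ss)) refl (Z<⟶ζ (2 ℕ.* s) (map (2 ℕ.*_) ss) (ℕ.≤-trans 0<s (ℕ.m≤m+n s _))))
      (⟶-* (Z<⟶ζ s ss 0<s) (Z<⟶ζ s ss 0<s))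

    ζ-1∷pows : ∀ r → ζ (1 ∷ pows r) ≈ D⁻¹ r * z ^2^ r
    ζ-1∷pows r = ⟶-unique
      (⟶-resp (Z<1∷pows r) refl (⟶-shift r (Z<⟶ζ 1 (pows r) (s≤s z≤n))))
      (⟶-resp (λ _ → refl) (*-congˡ (ζ-2^ r)) (⟶-* (⟶-const (D⁻¹ r)) (Z<⟶ζ (2 ℕ.^ r) [] (0<2^ r))))

    -- `∑ℓ*br1` contributes `ℓ n`, which cancels the divergent `L n`. The right side is arranged so
    -- that each of its m-dependent parts has a limit, the last one being 0.
    z*Z<pows : ∀ r m → ∑ (m ℕ.+ suc r) ℓ * Z< (pows (suc r)) (m ℕ.+ suc r) * br 1
      ≈ D⁻¹ (suc r) * (∑ (m ℕ.+ 1) ℓ ^2^ suc r * br 1 ^2^ suc r + (θ ^2^ suc r + θ ^2^ 1) * ℓ m ^2^ suc r)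
    z*Z<pows r m = begin
      ∑ (m ℕ.+ suc r) ℓ * Z< (pows (suc r)) (m ℕ.+ suc r) * br 1
        ≈⟨ *-congʳ (*-congˡ (Z<pows (suc r) m)) ⟩
      ∑ (m ℕ.+ suc r) ℓ * (L (m ℕ.+ suc r) * (D⁻¹ (suc r) * x)) * br 1
        ≈⟨ reflexive (≡.cong (λ n → ∑ n ℓ * (L n * (D⁻¹ (suc r) * x)) * br 1) (ℕ.+-suc m r)) ⟩
      ∑ (suc n) ℓ * (br (suc n) * L n * (D⁻¹ (suc r) * x)) * br 1
        ≈⟨ solve 5 (λ s t L i x′ → s :* (t :* L :* i) :* x′ := (s :* x′) :* (t :* L :* i)) refl
             (∑ (suc n) ℓ) (br (suc n)) (L n) (D⁻¹ (suc r) * x) (br 1) ⟩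
      ∑ (suc n) ℓ * br 1 * (br (suc n) * L n * (D⁻¹ (suc r) * x))
        ≈⟨ *-congʳ (∑ℓ*br1 n) ⟩
      br (suc n) * ℓ n * (br (suc n) * L n * (D⁻¹ (suc r) * x))
        ≈⟨ solve 5 (λ t l L i x → t :* l :* (t :* L :* (i :* x)) := (l :* L) :* (i :* ((t :* t) :* x))) refl
             (br (suc n)) (ℓ n) (L n) (D⁻¹ (suc r)) x ⟩
      ℓ n * L n * (D⁻¹ (suc r) * ((br (suc n) * br (suc n)) * x))
        ≈⟨ trans (*-congʳ (ℓ*L n)) (*-identityˡ _) ⟩
      D⁻¹ (suc r) * ((br (suc n) * br (suc n)) * x)
        -- Adding θ^{2^{r+1}} twice splits [n+1]² into [m+1]^{2^{r+1}}, which `∑ℓ*br1` turns back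
        -- into a partial sum, and a constant, whose product with `x` tends to 0.
        ≈⟨ *-congˡ (solve 4 (λ t θ q x → ((t :+ θ) :* (t :+ θ)) :* x
             := (t :* t :+ q) :* x :+ (q :+ θ :* θ) :* x) refl (θ ^2^ suc n) θ (θ ^2^ suc r) x) ⟩
      D⁻¹ (suc r) * ((θ ^2^ suc (suc n) + θ ^2^ suc r) * x + (θ ^2^ suc r + θ ^2^ 1) * x)
        ≈⟨ *-congˡ (+-congʳ (begin
             (θ ^2^ suc (suc n) + θ ^2^ suc r) * x
               ≈⟨ *-congʳ (+-congʳ (reflexive (≡.cong (λ k → θ ^2^ suc k) (ℕ.+-suc m r)))) ⟨
             (θ ^2^ (suc m ℕ.+ suc r) + θ ^2^ suc r) * x
               ≈⟨ *-congʳ (br-^2^ (suc m) (suc r)) ⟨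
             br (suc m) ^2^ suc r * x
               ≈⟨ ^2^-* (suc r) (br (suc m)) (ℓ m) ⟨
             (br (suc m) * ℓ m) ^2^ suc r
               ≈⟨ ^2^-cong (suc r) (∑ℓ*br1 m) ⟨
             (∑ (suc m) ℓ * br 1) ^2^ suc r
               ≈⟨ ^2^-* (suc r) (∑ (suc m) ℓ) (br 1) ⟩
             ∑ (suc m) ℓ ^2^ suc r * br 1 ^2^ suc r
               ≈⟨ *-congʳ (^2^-cong (suc r) (reflexive (≡.cong (λ k → ∑ k ℓ) (ℕ.+-comm m 1)))) ⟨
             ∑ (m ℕ.+ 1) ℓ ^2^ suc r * br 1 ^2^ suc r ∎)) ⟩
      D⁻¹ (suc r) * (∑ (m ℕ.+ 1) ℓ ^2^ suc r * br 1 ^2^ suc r + (θ ^2^ suc r + θ ^2^ 1) * x) ∎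
      where
      n : ℕ
      n = m ℕ.+ r
      x : Carrier
      x = ℓ m ^2^ suc r

    z*ζ-pows : ∀ r → z * ζ (pows (suc r)) * br 1 ≈ D⁻¹ (suc r) * (z ^2^ suc r * br 1 ^2^ suc r)
    z*ζ-pows r = ⟶-unique
      (⟶-resp (z*Z<pows r) refl (⟶-* (⟶-* (⟶-shift (suc r) ∑ℓ⟶z)
        (⟶-shift (suc r) (Z<⟶ζ 1 (map (2 ℕ.*_) (pows r)) (s≤s z≤n)))) (⟶-const (br 1))))
      (⟶-resp (λ _ → refl) (*-congˡ (begin
          y + w * 0# ^2^ suc r  ≈⟨ +-congˡ (trans (*-congˡ (0^2^ (suc r))) (zeroʳ w)) ⟩
          y + 0#                ≈⟨ +-identityʳ y ⟩
          y                     ∎))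
        (⟶-* (⟶-const (D⁻¹ (suc r)))
          (⟶-+ (⟶-* (⟶-^2^ (suc r) (⟶-shift 1 ∑ℓ⟶z)) (⟶-const (br 1 ^2^ suc r)))
               (⟶-* (⟶-const w) (⟶-^2^ (suc r) ℓ⟶0)))))
      where
      y w : Carrier
      y = z ^2^ suc r * br 1 ^2^ suc r
      w = θ ^2^ suc r + θ ^2^ 1

    module _ (k : ℕ) where
      private
        r : ℕ
        r = suc (suc k)
        quads : List ℕ
        quads = map (2 ℕ.*_) (map (2 ℕ.*_) (pows k))

      ζ-sum-formula : z * ζ (pows r) ≈ ζ (1 ∷ 3 ∷ quads) + ζ (1 ∷ pows (suc k)) * ζ (1 ∷ pows (suc k))
      -- By computation, `pows r` is `1 ∷ 2 ∷ quads`, and doubling `1 ∷ pows (suc k)` gives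
      -- `2 ∷ 2 ∷ quads`.
      ζ-sum-formula = trans (ζ-product quads) (+-congˡ (ζ-double 1 (pows (suc k)) (s≤s z≤n)))

      ζ-13-evaluation : ζ (1 ∷ 3 ∷ quads) ≈ ((br r + 1#) * J 1 * J r * ∏J 2 k) * ζ (2 ℕ.^ r ∷ [])
      ζ-13-evaluation = begin
        ζ (1 ∷ 3 ∷ quads)
          ≈⟨ +-moveʳ ζ-sum-formula ⟨
        z * ζ (pows r) + ζ (1 ∷ pows (suc k)) * ζ (1 ∷ pows (suc k))
          ≈⟨ +-cong (J1-cancel (z*ζ-pows (suc k))) (*-cong (ζ-1∷pows (suc k)) (ζ-1∷pows (suc k))) ⟩
        (j * ((J (suc k) * q) * (J (suc k) * q))) * (Y * B) * J 1
          + ((J (suc k) * q) * y) * ((J (suc k) * q) * y)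
          ≈⟨ solve 6 (λ j i q y B j1 → (j :* ((i :* q) :* (i :* q))) :* ((y :* y) :* B) :* j1
                 :+ ((i :* q) :* y) :* ((i :* q) :* y)
               := ((i :* i) :* (q :* q)) :* (y :* y) :* (j :* j1 :* B :+ con true :* con true)) refl
               j (J (suc k)) q y B (J 1) ⟩
        ((J (suc k) * J (suc k)) * (q * q)) * Y * (j * J 1 * B + 1# * 1#)
          -- The square term is expanded by [1][r] to share the denominator of the other term.
          ≈⟨ *-congˡ (+-congˡ (*-cong (J-inverse 0) (J-inverse (suc k)))) ⟨
        ((J (suc k) * J (suc k)) * (q * q)) * Y * (j * J 1 * B + (J 1 * br 1) * (j * br r))
          ≈⟨ *-congˡ (solve 5 (λ j j1 B b1 br → j :* j1 :* B :+ (j1 :* b1) :* (j :* br)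
               := j :* j1 :* (B :+ b1 :* br)) refl j (J 1) B (br 1) (br r)) ⟩
        ((J (suc k) * J (suc k)) * (q * q)) * Y * (j * J 1 * (B + br 1 * br r))
          ≈⟨ *-congˡ (*-congˡ (bracket-identity k)) ⟩
        ((J (suc k) * J (suc k)) * (q * q)) * Y * (j * J 1 * ((br r + 1#) * (br (suc k) * br (suc k))))
          ≈⟨ solve 7 (λ i q Y j j1 a t → ((i :* i) :* q) :* Y :* (j :* j1 :* (a :* (t :* t)))
               := (a :* j1 :* j :* q) :* Y :* ((i :* t) :* (i :* t))) refl
               (J (suc k)) (q * q) Y j (J 1) (br r + 1#) (br (suc k)) ⟩
        ((br r + 1#) * J 1 * j * (q * q)) * Y * ((J (suc k) * br (suc k)) * (J (suc k) * br (suc k)))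
          ≈⟨ *-congˡ (*-cong (J-inverse k) (J-inverse k)) ⟩
        ((br r + 1#) * J 1 * j * (q * q)) * Y * (1# * 1#)
          ≈⟨ trans (*-congˡ (*-identityˡ 1#)) (*-identityʳ _) ⟩
        ((br r + 1#) * J 1 * j * (q * q)) * Y
          ≈⟨ *-cong (*-congˡ (∏J≈D⁻¹ 2 k)) (ζ-2^ r) ⟨
        ((br r + 1#) * J 1 * j * ∏J 2 k) * ζ (2 ℕ.^ r ∷ []) ∎
        where
        j q y Y B : Carrier
        j = J r
        q = D⁻¹ k * D⁻¹ k
        y = z ^2^ suc k
        Y = y * y
        B = br 1 ^2^ r

    module _
      (factor : ℕ → Carrier) (factor≈ : ∀ j → factor j ≈ θ ^2^ suc j * J (suc j))
      (π₀ : Carrier) (∏⟶π₀ : (λ n → ∏ n factor) ⟶ π₀) where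

      -- The exponents add up as 2 + (2 + 4 + ... + 2^n) = 2^{n+1}; the prefactor θ² of the period
      -- supplies the first 2.
      ∏factor : ∀ n → (θ * θ) * ∏ n factor ≈ θ ^2^ suc n * ℓ n
      ∏factor zero    = *-congˡ (sym ℓ-0)
      ∏factor (suc n) = begin
        (θ * θ) * (∏ n factor * factor n)
          ≈⟨ *-assoc (θ * θ) (∏ n factor) (factor n) ⟨
        (θ * θ) * ∏ n factor * factor n
          ≈⟨ *-cong (∏factor n) (factor≈ n) ⟩
        t * ℓ n * (t * J (suc n))
          ≈⟨ solve 3 (λ t l j → t :* l :* (t :* j) := (t :* t) :* (j :* l)) refl t (ℓ n) (J (suc n)) ⟩
        (t * t) * (J (suc n) * ℓ n)
          ≈⟨ *-congˡ (ℓ-suc n) ⟨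
        (t * t) * ℓ (suc n) ∎
        where
        t : Carrier
        t = θ ^2^ suc n

      -- In [1] ∑ S_d(1) = [n+1] `ℓ n` the bracket has two terms: θ^{2^{n+1}} yields the truncated
      -- period by `∏factor`, and θ yields a null sequence.
      z*br1≈π : z * br 1 ≈ (θ * θ) * π₀
      z*br1≈π = ⟶-unique
        (⟶-resp (λ n → begin
            ∑ (n ℕ.+ 1) ℓ * br 1
              ≈⟨ reflexive (≡.cong (λ k → ∑ k ℓ * br 1) (ℕ.+-comm n 1)) ⟩
            ∑ (suc n) ℓ * br 1
              ≈⟨ ∑ℓ*br1 n ⟩
            (θ ^2^ suc n + θ) * ℓ n
              ≈⟨ distribʳ (ℓ n) (θ ^2^ suc n) θ ⟩
            θ ^2^ suc n * ℓ n + θ * ℓ n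
              ≈⟨ +-congʳ (∏factor n) ⟨
            (θ * θ) * ∏ n factor + θ * ℓ n ∎) refl
          (⟶-* (⟶-shift 1 ∑ℓ⟶z) (⟶-const (br 1))))
        (⟶-resp (λ _ → refl) (trans (+-congˡ (zeroʳ θ)) (+-identityʳ _))
          (⟶-+ (⟶-* (⟶-const (θ * θ)) ∏⟶π₀) (⟶-* (⟶-const θ) ℓ⟶0)))

      ζ-2^-π : ∀ r → ζ (2 ℕ.^ r ∷ []) ≈ ((θ * θ) * π₀) ^ (2 ℕ.^ r) * J 1 ^ (2 ℕ.^ r)
      ζ-2^-π r = begin
        ζ (2 ℕ.^ r ∷ [])                        ≈⟨ ζ-2^ r ⟩
        z ^2^ r                                 ≈⟨ ^2^-cong r (J1-cancel z*br1≈π) ⟩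
        ((θ * θ) * π₀ * J 1) ^2^ r              ≈⟨ ^2^-* r ((θ * θ) * π₀) (J 1) ⟩
        ((θ * θ) * π₀) ^2^ r * J 1 ^2^ r        ≈⟨ *-cong (^≈^2^ ((θ * θ) * π₀) r) (^≈^2^ (J 1) r) ⟨
        ((θ * θ) * π₀) ^ (2 ℕ.^ r) * J 1 ^ (2 ℕ.^ r) ∎

-- The power series ring F₂[[1/θ]] and its fraction field

open import Data.Nat using (_+_; _*_; _∸_; _^_; _≤_; _<_; _≤′_; ≤′-reflexive; ≤′-step)
open import Data.Nat.Properties using (+-∸-assoc; n∸n≡0; ≤-refl; ≤-trans; ≤-pred; <⇒≤; m<n⇒m<1+n; +-comm; +-identityʳ; +-mono-≤; ≤-reflexive; ≤′⇒≤; ≤⇒≤′; m∸n≤m; m≤m+n; m≤n+m; m+[n∸m]≡n; m∸n+n≡m; ∸-monoˡ-≤; *-monoʳ-≤; m^n>0)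
open import Relation.Binary.PropositionalEquality using (refl; sym; trans; cong; cong₂; subst; module ≡-Reasoning)

module F₂ = CharTwoSolver (CommutativeRing.commutativeSemiring xor-∧-commutativeRing) refl

Σ<-cong : ∀ n {h k : ℕ → Bool} → (∀ i → i < n → h i ≡ k i) → Σ< n h ≡ Σ< n k
Σ<-cong zero    h≡k = refl
Σ<-cong (suc n) h≡k = cong₂ _xor_ (Σ<-cong n (λ i i<n → h≡k i (m<n⇒m<1+n i<n))) (h≡k n ≤-refl)

Σ<-head : ∀ n (h : ℕ → Bool) → Σ< (suc n) h ≡ h 0 xor Σ< n (λ i → h (suc i))
Σ<-head zero    h = sym (xor-identityʳ (h 0))
Σ<-head (suc n) h = trans (cong (_xor h (suc n)) (Σ<-head n h)) (xor-assoc (h 0) _ _)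

Σ<-xor : ∀ n (h k : ℕ → Bool) → Σ< n (λ i → h i xor k i) ≡ Σ< n h xor Σ< n k
Σ<-xor zero    h k = refl
Σ<-xor (suc n) h k = trans (cong (_xor (h n xor k n)) (Σ<-xor n h k))
  (F₂.solve 4 (λ a b c d → (a F₂.:+ b) F₂.:+ (c F₂.:+ d) F₂.:= (a F₂.:+ c) F₂.:+ (b F₂.:+ d)) refl
     (Σ< n h) (Σ< n k) (h n) (k n))

Σ<-false : ∀ n → Σ< n (λ _ → false) ≡ false
Σ<-false zero    = refl
Σ<-false (suc n) = trans (xor-identityʳ _) (Σ<-false n)

tl : PS → PS
tl f n = f (suc n)

scale : Bool → PS → PS
scale b f n = b ∧ f n

-- Peeling the convolution at either end turns the ring laws into inductions over tails and avoids
-- rearranging double sums.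
⊛-suc : ∀ f g n → (f ⊛ g) (suc n) ≡ (f 0 ∧ g (suc n)) xor (tl f ⊛ g) n
⊛-suc f g n = Σ<-head (suc n) _

⊛-suc′ : ∀ f g n → (f ⊛ g) (suc n) ≡ (f ⊛ tl g) n xor (f (suc n) ∧ g 0)
⊛-suc′ f g n = cong₂ _xor_
  (Σ<-cong (suc n) (λ i i<1+n → cong (λ k → f i ∧ g k) (+-∸-assoc 1 (≤-pred i<1+n))))
  (cong (λ k → f (suc n) ∧ g k) (n∸n≡0 n))

⊛-cong : ∀ {f f′ g g′} → f ≗ₚ f′ → g ≗ₚ g′ → (f ⊛ g) ≗ₚ (f′ ⊛ g′)
⊛-cong f≗ g≗ n = Σ<-cong (suc n) (λ i _ → cong₂ _∧_ (f≗ i) (g≗ (n ∸ i)))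

⊛-comm : ∀ f g → (f ⊛ g) ≗ₚ (g ⊛ f)
⊛-comm f g zero    = ∧-comm (f 0) (g 0)
⊛-comm f g (suc n) = begin
  (f ⊛ g) (suc n)                        ≡⟨ ⊛-suc f g n ⟩
  (f 0 ∧ g (suc n)) xor (tl f ⊛ g) n     ≡⟨ cong₂ _xor_ (∧-comm (f 0) _) (⊛-comm (tl f) g n) ⟩
  (g (suc n) ∧ f 0) xor (g ⊛ tl f) n     ≡⟨ xor-comm (g (suc n) ∧ f 0) _ ⟩
  (g ⊛ tl f) n xor (g (suc n) ∧ f 0)     ≡⟨ ⊛-suc′ g f n ⟨
  (g ⊛ f) (suc n)                        ∎
  where open ≡-Reasoning

⊛-distribʳ : ∀ h f g → ((f ⊕ g) ⊛ h) ≗ₚ ((f ⊛ h) ⊕ (g ⊛ h))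
⊛-distribʳ h f g n = trans
  (Σ<-cong (suc n) (λ i _ → ∧-distribʳ-xor (h (n ∸ i)) (f i) (g i)))
  (Σ<-xor (suc n) (λ i → f i ∧ h (n ∸ i)) (λ i → g i ∧ h (n ∸ i)))

scale-⊛ : ∀ b f g → (scale b f ⊛ g) ≗ₚ scale b (f ⊛ g)
scale-⊛ true  f g n = refl
scale-⊛ false f g n = Σ<-false (suc n)

⊛-zeroˡ : ∀ f → (0ₚ ⊛ f) ≗ₚ 0ₚ
⊛-zeroˡ f n = Σ<-false (suc n)

⊛-identityˡ : ∀ f → (1ₚ ⊛ f) ≗ₚ f
⊛-identityˡ f zero    = refl
⊛-identityˡ f (suc n) = trans (⊛-suc 1ₚ f n)
  (trans (cong (f (suc n) xor_) (⊛-zeroˡ f n)) (xor-identityʳ _))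

⊛-assoc : ∀ f g h → ((f ⊛ g) ⊛ h) ≗ₚ (f ⊛ (g ⊛ h))
⊛-assoc f g h zero    = F₂.solve 3 (λ a b c → (a F₂.:* b) F₂.:* c F₂.:= a F₂.:* (b F₂.:* c)) refl (f 0) (g 0) (h 0)
⊛-assoc f g h (suc n) = begin
  ((f ⊛ g) ⊛ h) (suc n)
    ≡⟨ ⊛-suc (f ⊛ g) h n ⟩
  ((f 0 ∧ g 0) ∧ h (suc n)) xor (tl (f ⊛ g) ⊛ h) n
    ≡⟨ cong (((f 0 ∧ g 0) ∧ h (suc n)) xor_) (begin
        (tl (f ⊛ g) ⊛ h) n
          ≡⟨ ⊛-cong {g = h} (⊛-suc f g) (λ _ → refl) n ⟩
        ((scale (f 0) (tl g) ⊕ (tl f ⊛ g)) ⊛ h) n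
          ≡⟨ ⊛-distribʳ h (scale (f 0) (tl g)) (tl f ⊛ g) n ⟩
        (scale (f 0) (tl g) ⊛ h) n xor ((tl f ⊛ g) ⊛ h) n
          ≡⟨ cong₂ _xor_ (scale-⊛ (f 0) (tl g) h n) (⊛-assoc (tl f) g h n) ⟩
        (f 0 ∧ (tl g ⊛ h) n) xor (tl f ⊛ (g ⊛ h)) n ∎) ⟩
  ((f 0 ∧ g 0) ∧ h (suc n)) xor ((f 0 ∧ (tl g ⊛ h) n) xor (tl f ⊛ (g ⊛ h)) n)
    ≡⟨ F₂.solve 5 (λ a b c d e → ((a F₂.:* b) F₂.:* c) F₂.:+ ((a F₂.:* d) F₂.:+ e)
                    F₂.:= (a F₂.:* ((b F₂.:* c) F₂.:+ d)) F₂.:+ e) refl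
         (f 0) (g 0) (h (suc n)) ((tl g ⊛ h) n) ((tl f ⊛ (g ⊛ h)) n) ⟩
  (f 0 ∧ ((g 0 ∧ h (suc n)) xor (tl g ⊛ h) n)) xor (tl f ⊛ (g ⊛ h)) n
    ≡⟨ cong (λ b → (f 0 ∧ b) xor (tl f ⊛ (g ⊛ h)) n) (⊛-suc g h n) ⟨
  (f 0 ∧ (g ⊛ h) (suc n)) xor (tl f ⊛ (g ⊛ h)) n
    ≡⟨ ⊛-suc f (g ⊛ h) n ⟨
  (f ⊛ (g ⊛ h)) (suc n) ∎
  where open ≡-Reasoning

powerSeries : CommutativeSemiring 0ℓ 0ℓ
powerSeries = record
  { Carrier = PS
  ; _≈_ = _≗ₚ_
  ; _+_ = _⊕_
  ; _*_ = _⊛_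
  ; 0#  = 0ₚ
  ; 1#  = 1ₚ
  ; isCommutativeSemiring = isCommutativeSemiringˡ record
    { +-isCommutativeMonoid = record
      { isMonoid = record
        { isSemigroup = record
          { isMagma = record
            { isEquivalence = ≗-isEquivalence
            ; ∙-cong = λ f≗ g≗ n → cong₂ _xor_ (f≗ n) (g≗ n)
            }
          ; assoc = λ f g h n → xor-assoc (f n) (g n) (h n)
          }
        ; identity = (λ _ _ → refl) , (λ f n → xor-identityʳ (f n))
        }
      ; comm = λ f g n → xor-comm (f n) (g n)
      }
    ; *-isCommutativeMonoid = record
      { isMonoid = record
        { isSemigroup = record
          { isMagma = record
            { isEquivalence = ≗-isEquivalence
            ; ∙-cong = ⊛-cong
            }
          ; assoc = ⊛-assoc
          }
        ; identity = ⊛-identityˡ , (λ f n → trans (⊛-comm f 1ₚ n) (⊛-identityˡ f n))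
        }
      ; comm = ⊛-comm
      }
    ; distribʳ = ⊛-distribʳ
    ; zeroˡ = ⊛-zeroˡ
    }
  }
  where
  ≗-isEquivalence : IsEquivalence _≗ₚ_
  ≗-isEquivalence = record
    { refl  = λ _ → refl
    ; sym   = λ f≗g n → sym (f≗g n)
    ; trans = λ f≗g g≗h n → trans (f≗g n) (g≗h n)
    }

powerSeries-char2 : CharTwo powerSeries
powerSeries-char2 n = xor-same (1ₚ n)

module PSR = CommutativeSemiring powerSeries
module PSS = CharTwoSolver powerSeries powerSeries-char2

-- Powers of 1/θ and inverses of power series

infixr 8 u^_

u^_ : ℕ → PS
u^ n = shift n 1ₚ

shift-cong : ∀ d {f g} → f ≗ₚ g → shift d f ≗ₚ shift d g
shift-cong zero    f≗g n       = f≗g n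
shift-cong (suc d) f≗g zero    = refl
shift-cong (suc d) f≗g (suc n) = shift-cong d f≗g n

shift-injective : ∀ d {f g} → shift d f ≗ₚ shift d g → f ≗ₚ g
shift-injective zero    eq = eq
shift-injective (suc d) eq = shift-injective d (λ n → eq (suc n))

shift-+ : ∀ d e f → shift (d + e) f ≗ₚ shift d (shift e f)
shift-+ zero    e f n       = refl
shift-+ (suc d) e f zero    = refl
shift-+ (suc d) e f (suc n) = shift-+ d e f n

shift-⊛ : ∀ d f g → (shift d f ⊛ g) ≗ₚ shift d (f ⊛ g)
shift-⊛ zero    f g n       = refl
shift-⊛ (suc d) f g zero    = refl
shift-⊛ (suc d) f g (suc n) = trans (⊛-suc (shift (suc d) f) g n) (shift-⊛ d f g n)

shift≗u^⊛ : ∀ d f → shift d f ≗ₚ (u^ d ⊛ f)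
shift≗u^⊛ d f n = sym (trans (shift-⊛ d 1ₚ f n) (shift-cong d (⊛-identityˡ f) n))

u^-+ : ∀ d e → (u^ (d + e)) ≗ₚ (u^ d ⊛ u^ e)
u^-+ d e n = trans (shift-+ d e 1ₚ n) (shift≗u^⊛ d (u^ e) n)

u^-cancel : ∀ d {f g} → (u^ d ⊛ f) ≗ₚ (u^ d ⊛ g) → f ≗ₚ g
u^-cancel d {f} {g} eq =
  shift-injective d (λ n → trans (shift≗u^⊛ d f n) (trans (eq n) (sym (shift≗u^⊛ d g n))))

open PSS using (_:+_; _:*_; _:=_; con)

-- The monomial `u^ length xs` acts as the indicator of the appended position, so appending becomes
-- addition of a series.
nth-∷ʳ : ∀ xs b k → nth (xs ∷ʳ b) k ≡ nth xs k xor (b ∧ (u^ length xs) k)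
nth-∷ʳ []       b zero    = sym (∧-identityʳ b)
nth-∷ʳ []       b (suc k) = sym (∧-zeroʳ b)
nth-∷ʳ (x ∷ xs) b zero    = sym (trans (cong (x xor_) (∧-zeroʳ b)) (xor-identityʳ x))
nth-∷ʳ (x ∷ xs) b (suc k) = nth-∷ʳ xs b k

u^-below : ∀ {d n} → n < d → (u^ d) n ≡ false
u^-below {suc d} {zero}  _         = refl
u^-below {suc d} {suc n} (s≤s n<d) = u^-below n<d

u^-diagonal : ∀ d → (u^ d) d ≡ true
u^-diagonal zero    = refl
u^-diagonal (suc d) = u^-diagonal d

nth-beyond : ∀ xs k → length xs ≤ k → nth xs k ≡ false
nth-beyond []       k       _         = refl
nth-beyond (x ∷ xs) (suc k) (s≤s len) = nth-beyond xs k len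

length-wList : ∀ f n → length (wList f n) ≡ suc n
length-wList f zero    = refl
length-wList f (suc n) = trans (length-++ (wList f n)) (trans (+-comm _ 1) (cong suc (length-wList f n)))

-- `wList` only ever appends, so an entry keeps its value; this is what makes the lists for
-- different n fit together as one series.
nth-wList : ∀ f {k n} → k ≤′ n → nth (wList f n) k ≡ inv1p f k
nth-wList f (≤′-reflexive refl) = refl
nth-wList f {k} (≤′-step {n} k≤′n) = begin
  nth (wList f n ∷ʳ b) k                          ≡⟨ nth-∷ʳ (wList f n) b k ⟩
  nth (wList f n) k xor (b ∧ (u^ length (wList f n)) k)
    ≡⟨ cong (λ c → nth (wList f n) k xor (b ∧ c))
         (u^-below (subst (k <_) (sym (length-wList f n)) (s≤s (≤′⇒≤ k≤′n)))) ⟩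
  nth (wList f n) k xor (b ∧ false)               ≡⟨ cong (nth (wList f n) k xor_) (∧-zeroʳ b) ⟩
  nth (wList f n) k xor false                     ≡⟨ xor-identityʳ _ ⟩
  nth (wList f n) k                               ≡⟨ nth-wList f k≤′n ⟩
  inv1p f k                                       ∎
  where
  open ≡-Reasoning
  b : Bool
  b = Σ< (suc n) (λ j → f (suc j) ∧ nth (wList f n) (n ∸ j))

inv1p-suc : ∀ f n → inv1p f (suc n) ≡ (tl f ⊛ inv1p f) n
inv1p-suc f n = begin
  nth (wList f n ∷ʳ b) (suc n)
    ≡⟨ nth-∷ʳ (wList f n) b (suc n) ⟩
  nth (wList f n) (suc n) xor (b ∧ (u^ length (wList f n)) (suc n))
    ≡⟨ cong₂ (λ x y → x xor (b ∧ (u^ y) (suc n)))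
         (nth-beyond (wList f n) (suc n) (≤-reflexive (length-wList f n))) (length-wList f n) ⟩
  b ∧ (u^ suc n) (suc n)
    ≡⟨ cong (b ∧_) (u^-diagonal (suc n)) ⟩
  b ∧ true
    ≡⟨ ∧-identityʳ b ⟩
  b
    ≡⟨ Σ<-cong (suc n) (λ j _ → cong (f (suc j) ∧_) (nth-wList f (≤⇒≤′ (m∸n≤m n j)))) ⟩
  (tl f ⊛ inv1p f) n ∎
  where
  open ≡-Reasoning
  b : Bool
  b = Σ< (suc n) (λ j → f (suc j) ∧ nth (wList f n) (n ∸ j))

inv1p-fixpoint : ∀ f → f 0 ≡ false → inv1p f ≗ₚ (1ₚ ⊕ (f ⊛ inv1p f))
inv1p-fixpoint f f0 zero    = cong (λ b → true xor (b ∧ true)) (sym f0)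
inv1p-fixpoint f f0 (suc n) = trans (inv1p-suc f n) (sym (trans (⊛-suc f (inv1p f) n)
  (cong (λ b → (b ∧ inv1p f (suc n)) xor (tl f ⊛ inv1p f) n) f0)))

inv1p-inverse : ∀ f → f 0 ≡ false → (inv1p f ⊛ (1ₚ ⊕ f)) ≗ₚ 1ₚ
inv1p-inverse f f0 n = begin
  (w ⊛ (1ₚ ⊕ f)) n
    ≡⟨ PSS.solve 2 (λ w f → w :* (con true :+ f) := w :+ f :* w) (λ _ → refl) w f n ⟩
  w n xor (f ⊛ w) n
    ≡⟨ cong (_xor (f ⊛ w) n) (inv1p-fixpoint f f0 n) ⟩
  (1ₚ n xor (f ⊛ w) n) xor (f ⊛ w) n
    ≡⟨ F₂.solve 2 (λ a b → (a F₂.:+ b) F₂.:+ b F₂.:= a) refl (1ₚ n) ((f ⊛ w) n) ⟩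
  1ₚ n ∎
  where
  open ≡-Reasoning
  w : PS
  w = inv1p f

bit-⊛ : ∀ b f → (PSS.bit b ⊛ f) ≗ₚ scale b f
bit-⊛ true  f = ⊛-identityˡ f
bit-⊛ false f = ⊛-zeroˡ f

toPSrev-∷ : ∀ b l → toPSrev (b ∷ l) ≗ₚ (toPSrev l ⊕ (PSS.bit b ⊛ u^ suc (length l)))
toPSrev-∷ b l zero    = sym (trans (bit-⊛ b (u^ suc (length l)) 0) (∧-zeroʳ b))
toPSrev-∷ b l (suc k) = begin
  nth (reverse (b ∷ l)) k
    ≡⟨ cong (λ r → nth r k) (unfold-reverse b l) ⟩
  nth (reverse l ∷ʳ b) k
    ≡⟨ nth-∷ʳ (reverse l) b k ⟩
  nth (reverse l) k xor (b ∧ (u^ length (reverse l)) k)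
    ≡⟨ cong (λ m → nth (reverse l) k xor (b ∧ (u^ m) k)) (length-reverse l) ⟩
  nth (reverse l) k xor (b ∧ (u^ length l) k)
    ≡⟨ cong (nth (reverse l) k xor_) (bit-⊛ b (u^ suc (length l)) (suc k)) ⟨
  nth (reverse l) k xor (PSS.bit b ⊛ u^ suc (length l)) (suc k) ∎
  where open ≡-Reasoning

reverse-∷ʳ : ∀ (l : List Bool) b → reverse (l ∷ʳ b) ≡ b ∷ reverse l
reverse-∷ʳ l b = reverse-++ l (b ∷ [])

toPSrev-∷ʳtrue : ∀ l → toPSrev (l ∷ʳ true) ≗ₚ shift 1 (1ₚ ⊕ toPSrev l)
toPSrev-∷ʳtrue l zero          = refl
toPSrev-∷ʳtrue l (suc zero)    = cong (λ r → nth r 0) (reverse-∷ʳ l true)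
toPSrev-∷ʳtrue l (suc (suc k)) = cong (λ r → nth r (suc k)) (reverse-∷ʳ l true)

recipPoly-∷ʳtrue : ∀ l → recipPoly (l ∷ʳ true) ≡ recipMonic l
recipPoly-∷ʳtrue l rewrite reverse-∷ʳ l true | reverse-involutive l = refl

-- The lower coefficients of [k] + b = θ^{2^k} + θ + b, for k ≥ 1.
brkTail : Bool → ℕ → List Bool
brkTail b k = b ∷ true ∷ replicate (2 ^ k ∸ 2) false

2+[2^k∸2] : ∀ k → 2 + (2 ^ suc k ∸ 2) ≡ 2 ^ suc k
2+[2^k∸2] k = m+[n∸m]≡n (*-monoʳ-≤ 2 (m^n>0 2 k))

addP-[]ʳ : ∀ p → addP p [] ≡ p
addP-[]ʳ []      = refl
addP-[]ʳ (_ ∷ _) = refl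

-- Once the exponent 2^{k+1} is exposed as 2 plus a remainder, `addP` computes through the two
-- entries of θ.
brk≡ : ∀ k → brk (suc k) ≡ brkTail false (suc k) ∷ʳ true
brk≡ k = trans (cong (λ n → addP (mono n) (mono 1)) (sym (2+[2^k∸2] k)))
  (cong (λ p → false ∷ true ∷ p) (addP-[]ʳ (mono (2 ^ suc k ∸ 2))))

brk+1≡ : ∀ k → addP (brk (suc k)) (true ∷ []) ≡ brkTail true (suc k) ∷ʳ true
brk+1≡ k = cong (λ p → addP p (true ∷ [])) (brk≡ k)

psDenominators : Denominators powerSeries
psDenominators = record
  { U        = u^_
  ; U-0      = λ { zero → refl ; (suc _) → refl }
  ; U-+      = u^-+
  ; U-cancel = u^-cancel
  }

-- Laurent series as fractions

open Localisation powerSeries powerSeries-char2 psDenominators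

module LF = CommutativeSemiring fractions
module LS = CharTwoSolver fractions fractions-char2
open Algebra.Properties.Semiring.Exp LF.semiring using (^-congˡ) renaming (_^_ to _^F_)
open import Relation.Binary.Reasoning.Setoid LF.setoid as ≈F-Reasoning using ()

fromLaurent : Laurent → Fraction
fromLaurent (θ^ e · f) = f /U^ e

fromLaurent-reflects : ∀ x y → fromLaurent x ≈F fromLaurent y → x ≈L y
fromLaurent-reflects (θ^ e · f) (θ^ e′ · g) (cross eq) n =
  trans (shift≗u^⊛ e′ f n) (trans (eq n) (sym (shift≗u^⊛ e g n)))

fromLaurent-^ : ∀ x n → fromLaurent (x ^L n) ≡ fromLaurent x ^F n
fromLaurent-^ x zero    = refl
fromLaurent-^ x (suc n) = cong (fromLaurent x *F_) (fromLaurent-^ x n)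

fromLaurent-prod : ∀ xs → fromLaurent (prodL xs) ≡ foldr _*F_ 1F (map fromLaurent xs)
fromLaurent-prod []       = refl
fromLaurent-prod (x ∷ xs) = cong (fromLaurent x *F_) (fromLaurent-prod xs)

ι-sum : ∀ fs → ι (sumPS fs) ≈F foldr _+F_ 0F (map ι fs)
ι-sum []       = LF.refl
ι-sum (f ∷ fs) = LF.trans (ι-+ f (sumPS fs)) (LF.+-congˡ {ι f} (ι-sum fs))

ι-prod : ∀ fs → ι (prodPS fs) ≡ foldr _*F_ 1F (map ι fs)
ι-prod []       = refl
ι-prod (f ∷ fs) = cong (ι f *F_) (ι-prod fs)

ι-^ : ∀ f s → ι (f ^ₚ s) ≡ ι f ^F s
ι-^ f zero    = refl
ι-^ f (suc s) = cong (ι f *F_) (ι-^ f s)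

-- Factoring out the leading power of θ leaves exactly the series that `recipMonic` inverts.
monicAt-θF : ∀ l → LS.monicAt θF l ≈F (1ₚ ⊕ toPSrev l) /U^ length l
monicAt-θF []      = same-exp refl (λ { zero → refl ; (suc _) → refl })
monicAt-θF (b ∷ l) = begin
  LS.bit b +F θF *F LS.monicAt θF l
    ≈⟨ LF.+-congˡ {LS.bit b} (LF.*-congˡ {θF} (monicAt-θF l)) ⟩
  LS.bit b +F θF *F ((1ₚ ⊕ toPSrev l) /U^ length l)
    ≈⟨ bit+θF* b (1ₚ ⊕ toPSrev l) (length l) ⟩
  ((1ₚ ⊕ toPSrev l) ⊕ (PSS.bit b ⊛ u^ suc (length l))) /U^ suc (length l)
    ≈⟨ same-exp refl (λ n → trans (xor-assoc (1ₚ n) _ _) (cong (1ₚ n xor_) (sym (toPSrev-∷ b l n)))) ⟩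
  (1ₚ ⊕ toPSrev (b ∷ l)) /U^ suc (length l) ∎
  where open ≈F-Reasoning

recipMonic-inverse : ∀ l → ι (recipMonic l) *F LS.monicAt θF l ≈F 1F
recipMonic-inverse l = begin
  ι (recipMonic l) *F LS.monicAt θF l
    ≈⟨ LF.*-congˡ {ι (recipMonic l)} (monicAt-θF l) ⟩
  (shift d w ⊛ (1ₚ ⊕ toPSrev l)) /U^ d
    ≈⟨ same-exp (sym (+-identityʳ d)) (λ n → trans (shift-⊛ d w (1ₚ ⊕ toPSrev l) n)
         (trans (shift-cong d (inv1p-inverse (toPSrev l) refl) n) (shift≗u^⊛ d 1ₚ n))) ⟩
  (u^ d ⊛ 1ₚ) /U^ (d + 0)
    ≈⟨ cancel-exp d 0 1ₚ ⟩
  1F ∎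
  where
  open ≈F-Reasoning
  d : ℕ
  d = length l
  w : PS
  w = inv1p (toPSrev l)


monicAt-brkTail : ∀ b k →
  LS.monicAt θF (brkTail b (suc k)) ≈F (LS._^2^_ θF (suc k) +F θF) +F LS.bit b
monicAt-brkTail b k = LF.trans (LS.monicAt-trinomial θF b n)
  (LF.+-congʳ {LS.bit b} {θF ^F (2 + n) +F θF} (LF.+-congʳ {θF} {θF ^F (2 + n)} θ^2^))
  where
  n : ℕ
  n = 2 ^ suc k ∸ 2
  θ^2^ : θF ^F (2 + n) ≈F LS._^2^_ θF (suc k)
  θ^2^ = LF.trans (LF.reflexive (cong (θF ^F_) (2+[2^k∸2] k))) (LS.^≈^2^ θF (suc k))

recipBrk-inverse : ∀ k → ι (recipPoly (brk (suc k))) *F (LS._^2^_ θF (suc k) +F θF) ≈F 1F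
recipBrk-inverse k = subst (λ f → ι f *F (LS._^2^_ θF (suc k) +F θF) ≈F 1F)
  (sym (trans (cong recipPoly (brk≡ k)) (recipPoly-∷ʳtrue (brkTail false (suc k)))))
  (LF.trans
    (LF.*-congˡ {ι (recipMonic (brkTail false (suc k)))}
      (LF.sym (LF.trans (monicAt-brkTail false k) (LF.+-identityʳ (LS._^2^_ θF (suc k) +F θF)))))
    (recipMonic-inverse (brkTail false (suc k))))

-- The valuation on Laurent series

IntegralF : Fraction → Set
IntegralF x = ∃ λ f → x ≈F ι f

SmallF : ℕ → Fraction → Set
SmallF N x = ∃ λ y → IntegralF y × x ≈F uF ^F N *F y

shift-below : ∀ d f {n} → n < d → shift d f n ≡ false
shift-below (suc d) f {zero}  _         = refl
shift-below (suc d) f {suc n} (s≤s n<d) = shift-below d f n<d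

SmallF⇒vanishes : ∀ {N e f} → SmallF N (f /U^ e) → ∀ {n} → n < N → f n ≡ false
SmallF⇒vanishes {N} {e} {f} (y , (g , y≈) , x≈) {n} n<N = begin
  f n                       ≡⟨ shift≗u^⊛ 0 f n ⟩
  (u^ 0 ⊛ f) n              ≡⟨ uncross f≈ n ⟩
  (u^ e ⊛ (u^ N ⊛ g)) n     ≡⟨ ⊛-assoc (u^ e) (u^ N) g n ⟨
  ((u^ e ⊛ u^ N) ⊛ g) n     ≡⟨ ⊛-cong {g = g} (u^-+ e N) (λ _ → refl) n ⟨
  (u^ (e + N) ⊛ g) n        ≡⟨ shift≗u^⊛ (e + N) g n ⟨
  shift (e + N) g n         ≡⟨ shift-below (e + N) g (≤-trans n<N (m≤n+m N e)) ⟩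
  false                     ∎
  where
  open ≡-Reasoning
  f≈ : f /U^ e ≈F ι (u^ N ⊛ g)
  f≈ = LF.trans x≈ (LF.trans (LF.*-congˡ {uF ^F N} y≈) (LF.sym (ι-U* N g)))

vanishes⇒SmallF : ∀ N f → (∀ n → n < N → f n ≡ false) → SmallF N (ι f)
vanishes⇒SmallF N f vanishes = ι g , (g , LF.refl) , LF.trans (ι-cong f≗) (ι-U* N g)
  where
  g : PS
  g k = f (N + k)
  go : ∀ N f → (∀ n → n < N → f n ≡ false) → f ≗ₚ shift N (λ k → f (N + k))
  go zero    f _        n       = refl
  go (suc N) f vanishes zero    = vanishes 0 (s≤s z≤n)
  go (suc N) f vanishes (suc n) = go N (tl f) (λ k k<N → vanishes (suc k) (s≤s k<N)) n
  f≗ : f ≗ₚ (u^ N ⊛ g)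
  f≗ n = trans (go N f vanishes n) (shift≗u^⊛ N g n)

laurentSeries : CarlitzData
laurentSeries = record
  { K             = fractions
  ; char2         = fractions-char2
  ; θ             = θF
  ; u             = uF
  ; I             = λ l → ι (recipMonic l)
  ; I-inverse     = recipMonic-inverse
  ; J             = λ k → ι (recipPoly (brk k))
  ; J-inverse     = recipBrk-inverse
  ; Integral      = IntegralF
  ; Integral-resp = λ { x≈y (f , x≈) → f , LF.trans (LF.sym x≈y) x≈ }
  ; Integral-0    = 0ₚ , LF.refl
  ; Integral-1    = 1ₚ , LF.refl
  ; Integral-u    = u^ 1 , LF.refl
  ; Integral-+    = λ { (f , x≈) (g , y≈) → f ⊕ g , LF.trans (LF.+-cong x≈ y≈) (LF.sym (ι-+ f g)) }
  ; Integral-*    = λ { (f , x≈) (g , y≈) → f ⊛ g , LF.*-cong x≈ y≈ }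
  ; denominator   = λ { (f /U^ e) → e , f , uF^-cancel e f }
  ; I-small       = λ l → let w = inv1p (toPSrev l) in
      ι w , (w , LF.refl) , LF.trans (ι-cong (shift≗u^⊛ (length l) w)) (ι-U* (length l) w)
  ; separated     = λ { {f /U^ e} small → LF.trans
      (same-exp refl (λ n → SmallF⇒vanishes (small (suc n)) ≤-refl))
      (cross (PSS.solve 1 (λ a → con true :* con false := a :* con false) (λ _ → refl) (u^ e))) }
  }

open CarlitzData laurentSeries using (Small; br; J)
open Carlitz laurentSeries

-- The given definitions as limits of truncated sums and products

coefficientwise-limit : ∀ (a : ℕ → PS) f → (∀ n → f n ≡ a (suc n) n) →
  Cauchy (λ n → ι (a n)) → (λ n → ι (a n)) ⟶ ι f
coefficientwise-limit a f f≡ cauchy N = N , λ n N≤n →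
  Small-resp N (ι-+ (a n) f) (vanishes⇒SmallF N (a n ⊕ f) (λ k k<N →
    trans (cong (a n k xor_) (f≡ k))
      -- Agreement with the member of index `suc k` to precision `suc k` just covers coefficient k.
      (SmallF⇒vanishes (Small-resp (suc k) (LF.sym (ι-+ (a n) (a (suc k)))) (cauchy (≤-trans k<N N≤n))) ≤-refl)))

Cauchy-resp : ∀ {a b} → (∀ n → a n ≈F b n) → Cauchy a → Cauchy b
Cauchy-resp a≈b cauchy {N} {n} N≤n = Small-resp N (LF.+-cong (a≈b n) (a≈b N)) (cauchy N≤n)

sum-pairs : ∀ (h : List Bool → PS) ls →
  sumPS (map h (concatMap (λ l → (false ∷ l) ∷ (true ∷ l) ∷ []) ls))
    ≗ₚ sumPS (map (λ l → h (false ∷ l) ⊕ h (true ∷ l)) ls)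
sum-pairs h []       n = refl
sum-pairs h (l ∷ ls) n = trans (cong (λ b → h (false ∷ l) n xor (h (true ∷ l) n xor b)) (sum-pairs h ls n))
  (sym (xor-assoc (h (false ∷ l) n) (h (true ∷ l) n) _))

ι-∑lists : ∀ d h → ι (sumPS (map h (allLists d))) ≈F ∑lists d (λ l → ι (h l))
ι-∑lists zero    h = ι-cong (λ n → xor-identityʳ (h [] n))
ι-∑lists (suc d) h = LF.trans (ι-cong (sum-pairs h (allLists d)))
  (LF.trans (ι-∑lists d (λ l → h (false ∷ l) ⊕ h (true ∷ l)))
    (∑lists-cong d (λ l → ι-+ (h (false ∷ l)) (h (true ∷ l)))))

ι-S : ∀ d s → ι (S d s) ≈F Sd d s
ι-S d s = LF.trans (ι-∑lists d (λ l → recipMonic l ^ₚ s)) (∑lists-cong d (λ l → LF.reflexive (ι-^ (recipMonic l) s)))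

ι-∑ : ∀ (h : ℕ → PS) n → ι (sumPS (map h (upTo n))) ≈F ∑ n (λ i → ι (h i))
ι-∑ h n = LF.trans (ι-sum (map h (upTo n))) (LF.trans
  (LF.reflexive (cong (foldr _+F_ 0F) (trans (cong (map ι) (map-upTo h n)) (map-applyUpTo h ι n))))
  (foldr-applyUpTo-∑ (λ i → ι (h i)) n))

ι-∏ : ∀ (h : ℕ → PS) n → ι (prodPS (map h (upTo n))) ≈F ∏ n (λ i → ι (h i))
ι-∏ h n = LF.trans
  (LF.reflexive (trans (ι-prod (map h (upTo n)))
    (cong (foldr _*F_ 1F) (trans (cong (map ι) (map-upTo h n)) (map-applyUpTo h ι n)))))
  (foldr-applyUpTo-∏ (λ i → ι (h i)) n)

ι-Z : ∀ ss n → ι (Z ss n) ≈F Z< ss n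
ι-Z []       n = LF.refl
ι-Z (s ∷ ss) n = LF.trans (ι-∑ (λ d → S d s ⊛ Z ss d) n)
  (∑-cong n (λ d → LF.*-cong (ι-S d s) (ι-Z ss d)))

Z<⟶ζA : ∀ s ss → 0 < s → Z< (s ∷ ss) ⟶ ι (ζA (s ∷ ss))
Z<⟶ζA s ss 0<s = ⟶-resp (ι-Z (s ∷ ss)) (LF.refl {ι (ζA (s ∷ ss))})
  (coefficientwise-limit (Z (s ∷ ss)) (ζA (s ∷ ss)) (λ _ → refl)
    (Cauchy-resp (λ n → LF.sym (ι-Z (s ∷ ss) n)) (Z<-Cauchy s ss 0<s)))

open Zeta (λ ss → ι (ζA ss)) Z<⟶ζA

n<2^n : ∀ n → n < 2 ^ n
n<2^n zero    = s≤s z≤n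
n<2^n (suc n) = +-mono-≤ (m^n>0 2 n) (≤-trans (n<2^n n) (m≤m+n (2 ^ n) 0))

πExp : ℕ → ℕ
πExp j = 2 ^ suc j ∸ 1

1+πExp : ∀ j → πExp j + 1 ≡ 2 ^ suc j
1+πExp j = m∸n+n≡m (m^n>0 2 (suc j))

j<πExp : ∀ j → j < πExp j
j<πExp j = ∸-monoˡ-≤ 1 (n<2^n (suc j))

πFactor : ℕ → PS
πFactor j = inv1p (u^ πExp j)

πFactor≈ : ∀ j → ι (πFactor j) ≈F LS._^2^_ θF (suc j) *F J (suc j)
πFactor≈ j = geometric≈ j {ι w} {ι (u^ m)}
  (LF.trans (LF.*-congˡ {ι w} (LF.sym (ι-+ 1ₚ (u^ m)))) (ι-cong (inv1p-inverse (u^ m) u^m-0)))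
  (begin
    -- As m + 1 = 2^{j+1}, all but one of the powers of θ cancel.
    LS._^2^_ θF (suc j) *F ι (u^ m)    ≈⟨ LF.*-congʳ {ι (u^ m)} θ^≈ ⟨
    (1ₚ /U^ (m + 1)) *F ι (u^ m)       ≈⟨ same-exp (+-identityʳ (m + 1)) (⊛-comm 1ₚ (u^ m)) ⟩
    (u^ m ⊛ 1ₚ) /U^ (m + 1)            ≈⟨ cancel-exp m 1 1ₚ ⟩
    θF                                 ∎)
  where
  open ≈F-Reasoning
  m : ℕ
  m = πExp j
  w : PS
  w = πFactor j
  u^m-0 : (u^ m) 0 ≡ false
  u^m-0 = u^-below (≤-trans (s≤s z≤n) (j<πExp j))
  θ^≈ : 1ₚ /U^ (m + 1) ≈F LS._^2^_ θF (suc j)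
  θ^≈ = LF.trans (LF.sym (θF^ (m + 1))) (LF.trans (LF.reflexive (cong (θF ^F_) (1+πExp j))) (LS.^≈^2^ θF (suc j)))

πFactor-near-1 : ∀ j → Small j (ι (πFactor j) +F 1F)
πFactor-near-1 j = Small-anti (<⇒≤ (j<πExp j)) (ι w , (w , LF.refl) , (begin
  ι w +F 1F         ≈⟨ ι-+ w 1ₚ ⟨
  ι (w ⊕ 1ₚ)        ≈⟨ ι-cong (λ n → trans (cong (_xor 1ₚ n) (inv1p-fixpoint (u^ m) u^m-0 n))
                         (F₂.solve 2 (λ a b → (a F₂.:+ b) F₂.:+ a F₂.:= b) refl (1ₚ n) ((u^ m ⊛ w) n))) ⟩
  ι (u^ m ⊛ w)      ≈⟨ ι-U* m w ⟩
  uF ^F m *F ι w    ∎))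
  where
  open ≈F-Reasoning
  m : ℕ
  m = πExp j
  w : PS
  w = πFactor j
  u^m-0 : (u^ m) 0 ≡ false
  u^m-0 = u^-below (≤-trans (s≤s z≤n) (j<πExp j))

∏⟶πProd : (λ n → ∏ n (λ j → ι (πFactor j))) ⟶ ι πProd
∏⟶πProd = ⟶-resp (ι-∏ πFactor) (LF.refl {ι πProd})
  (coefficientwise-limit (λ n → prodPS (map πFactor (upTo n))) πProd (λ _ → refl)
    (Cauchy-resp (λ n → LF.sym (ι-∏ πFactor n))
      (∏-Cauchy (λ j → ι (πFactor j)) (λ j → πFactor j , LF.refl) πFactor-near-1)))

-- Tuples, the rational coefficient and the theorem

tupA≡ : ∀ r → tupA r ≡ pows r
tupA≡ r = trans (map-upTo (2 ^_) r) (go r)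
  where
  go : ∀ r → applyUpTo (2 ^_) r ≡ pows r
  go zero    = refl
  go (suc r) = cong (1 ∷_) (trans (sym (map-applyUpTo (2 ^_) (2 *_) r)) (cong (map (2 *_)) (go r)))

tupB≡ : ∀ k → tupB (2 + k) ≡ 1 ∷ 3 ∷ map (2 *_) (map (2 *_) (pows k))
tupB≡ k = cong (λ ss → 1 ∷ 3 ∷ ss) (begin
  map (λ i → 2 ^ (i + 2)) (upTo k)              ≡⟨ map-cong (λ i → cong (2 ^_) (+-comm i 2)) (upTo k) ⟩
  map (λ i → 2 * (2 * 2 ^ i)) (upTo k)          ≡⟨ map-∘ (upTo k) ⟩
  map (2 *_) (map (λ i → 2 * 2 ^ i) (upTo k))   ≡⟨ cong (map (2 *_)) (map-∘ (upTo k)) ⟩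
  map (2 *_) (map (2 *_) (tupA k))              ≡⟨ cong (λ ss → map (2 *_) (map (2 *_) ss)) (tupA≡ k) ⟩
  map (2 *_) (map (2 *_) (pows k))              ∎)
  where open ≡-Reasoning

fromLaurent-poly : ∀ l → fromLaurent (poly→L (l ∷ʳ true)) ≈F LS.monicAt θF l
fromLaurent-poly l = begin
  toPSrev (l ∷ʳ true) /U^ length (l ∷ʳ true)
    ≈⟨ same-exp (trans (length-++ l) (+-comm (length l) 1))
         (λ n → trans (toPSrev-∷ʳtrue l n) (shift≗u^⊛ 1 (1ₚ ⊕ toPSrev l) n)) ⟩
  (u^ 1 ⊛ (1ₚ ⊕ toPSrev l)) /U^ (1 + length l)
    ≈⟨ cancel-exp 1 (length l) (1ₚ ⊕ toPSrev l) ⟩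
  (1ₚ ⊕ toPSrev l) /U^ length l
    ≈⟨ monicAt-θF l ⟨
  LS.monicAt θF l ∎
  where open ≈F-Reasoning

fromLaurent-coeff : ∀ k → fromLaurent (coeff (2 + k)) ≈F (br (2 + k) +F 1F) *F J 1 *F J (2 + k) *F ∏J 2 k
fromLaurent-coeff k = LF.*-cong
  (LF.*-congʳ {J (2 + k)} (LF.*-congʳ {J 1} bracket))
  (LF.trans (LF.reflexive recips) (foldr-applyUpTo-∏ h k))
  where
  h : ℕ → Fraction
  h j = J (suc j) ^F (2 ^ ((2 + k) ∸ suc j))
  g : ℕ → Laurent
  g j = recipL (brk (suc j)) ^L (2 ^ ((2 + k) ∸ suc j))
  bracket : fromLaurent (poly→L (addP (brk (2 + k)) (true ∷ []))) ≈F br (2 + k) +F 1F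
  bracket = LF.trans (LF.reflexive (cong (λ p → fromLaurent (poly→L p)) (brk+1≡ (suc k))))
    (LF.trans (fromLaurent-poly (brkTail true (2 + k))) (monicAt-brkTail true (suc k)))
  recips : fromLaurent (prodL (map g (upTo k))) ≡ foldr _*F_ 1F (applyUpTo h k)
  recips = trans (fromLaurent-prod (map g (upTo k))) (cong (foldr _*F_ 1F) (begin
    map fromLaurent (map g (upTo k))    ≡⟨ map-∘ (upTo k) ⟨
    map (λ j → fromLaurent (g j)) (upTo k)
      ≡⟨ map-cong (λ j → fromLaurent-^ (recipL (brk (suc j))) (2 ^ ((2 + k) ∸ suc j))) (upTo k) ⟩
    map h (upTo k)                      ≡⟨ map-upTo h k ⟩
    applyUpTo h k                       ∎))
    where open ≡-Reasoning

-- The tuples are variables tied by equations, so that matching on `refl` transfers the identity to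
-- the tuples of the statement without rewriting inside `ζA`.
sum-formula : ∀ k {as bs cs} →
  as ≡ pows (2 + k) → bs ≡ 1 ∷ 3 ∷ map (2 *_) (map (2 *_) (pows k)) → cs ≡ 1 ∷ pows (suc k) →
  (ζA (1 ∷ []) ⊛ ζA as) ≗ₚ (ζA bs ⊕ (ζA cs ⊛ ζA cs))
sum-formula k {bs = bs} {cs} refl refl refl = ι-injective
  (LF.trans (ζ-sum-formula k) (LF.sym (ι-+ (ζA bs) (ζA cs ⊛ ζA cs))))

evaluation : ∀ k → ι (ζA (tupB (2 + k))) ≈F fromLaurent (coeff (2 + k)) *F ι (ζA (2 ^ (2 + k) ∷ []))
evaluation k = LF.trans (LF.reflexive (cong (λ ss → ι (ζA ss)) (tupB≡ k)))
  (LF.trans (ζ-13-evaluation k) (LF.*-congʳ {ι (ζA (2 ^ (2 + k) ∷ []))} (LF.sym (fromLaurent-coeff k))))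

ζA-2^-π̃ : ∀ r → ι (ζA (2 ^ r ∷ [])) ≈F fromLaurent ((π̃ ^L (2 ^ r)) ·L (recipL L₁ ^L (2 ^ r)))
ζA-2^-π̃ r = LF.trans (ζ-2^-π (λ j → ι (πFactor j)) πFactor≈ (ι πProd) ∏⟶πProd r)
  (LF.*-cong
    (LF.trans (^-congˡ (2 ^ r) π̃≈) (LF.reflexive (sym (fromLaurent-^ π̃ (2 ^ r)))))
    (LF.reflexive (sym (fromLaurent-^ (recipL L₁) (2 ^ r)))))
  where
  π̃≈ : θF *F θF *F ι πProd ≈F fromLaurent π̃
  π̃≈ = same-exp refl (PSS.solve 1 (λ p → con true :* con true :* p := p) (λ _ → refl) πProd)

theorem5p2 : (r : ℕ) → 1 < r →
    ((ζA (1 ∷ []) ⊛ ζA (tupA r)) ≗ₚ (ζA (tupB r) ⊕ (ζA (tupC r) ⊛ ζA (tupC r))))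
    × (ser→L (ζA (tupB r)) ≈L (coeff r ·L ((π̃ ^L (2 ^ r)) ·L (recipL L₁ ^L (2 ^ r)))))
    × (ser→L (ζA (tupB r)) ≈L (coeff r ·L ser→L (ζA ((2 ^ r) ∷ []))))
theorem5p2 (suc (suc k)) (s≤s (s≤s _)) =
    sum-formula k (tupA≡ (2 + k)) (tupB≡ k) (cong (1 ∷_) (tupA≡ (suc k)))
  , fromLaurent-reflects (ser→L (ζA (tupB r))) (coeff r ·L ((π̃ ^L (2 ^ r)) ·L (recipL L₁ ^L (2 ^ r))))
      (LF.trans (evaluation k) (LF.*-congˡ {fromLaurent (coeff r)} (ζA-2^-π̃ r)))
  , fromLaurent-reflects (ser→L (ζA (tupB r))) (coeff r ·L ser→L (ζA ((2 ^ r) ∷ []))) (evaluation k)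
  where
  r : ℕ
  r = 2 + k
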